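{- Let $m,n,r,s,\lambda$ be positive integers with $n>m>2$. An $r$-factorization of $\lambda K_m$ can be extended to a connected $s$-factorization of $\lambda K_n$ if and only if (i) $(m,r,\lambda)$ and $(n,s,\lambda)$ are $2$-admissible; (ii) $1<s/r\le (n-1)/(m-1)$; (iii) $n\ge 2m$ if $s/r<(n-1)/(m-1)$.
   Context: $\lambda K_n$ is the loopless multigraph on $n$ vertices with every pair joined by $\lambda$ edges; $\lambda K_m$ is its subgraph induced on a fixed set of $m$ vertices. An $r$-factor is a spanning subgraph with all degrees $r$; an $r$-factorization is a partition of the edges into $r$-factors. An $r$-factorization of $\lambda K_m$ extends to a connected $s$-factorization of $\lambda K_n$ if there is a partition of the edges of $\lambda K_n$ into connected $s$-factors such that each given $r$-factor is contained in one of them and distinct $r$-factors are contained in distinct $s$-factors. $(n,r,\lambda)$ is $2$-admissible if $2\mid rn$ and $r\mid\lambda(n-1)$. -}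

module Defs where

open import Data.Nat using (ℕ; _+_; _*_; _∸_; _≤_; _<_)
open import Data.Nat.Divisibility using (_∣_)
open import Data.Fin using (Fin; inject≤)
open import Data.Fin.Properties using (_≟_)
open import Data.List using (List; length; filter; allFin; cartesianProduct)
open import Data.Product using (Σ; ∃; _×_; _,_; proj₁; proj₂)
open import Relation.Nullary using (¬_; ¬?)
open import Relation.Nullary.Decidable using (_×-dec_)
open import Relation.Binary.PropositionalEquality using (_≡_; _≢_)
open import Function.Definitions using (Injective)

-- The multigraph lam K_n on vertex set Fin n: for each ordered pair i ≢ j there
-- are lam parallel edges, labelled by Fin lam; the edge (i,j,k) is the same edge
-- as (j,i,k).  An edge-colouring with q colours is a function
-- col : Fin n → Fin n → Fin lam → Fin q which is symmetric in i,j (values on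
-- the diagonal i ≡ j are irrelevant junk; there are no loops).

Colouring : ℕ → ℕ → ℕ → Set
Colouring n lam q = Fin n → Fin n → Fin lam → Fin q

deg : ∀ {n lam q} → Colouring n lam q → Fin q → Fin n → ℕ
deg {n} {lam} col c v =
  length (filter (λ p → ¬? (proj₁ p ≟ v) ×-dec (col v (proj₁ p) (proj₂ p) ≟ c))
                 (cartesianProduct (allFin n) (allFin lam)))

record Factorization (n lam r : ℕ) : Set where
  field
    q       : ℕ
    col     : Colouring n lam q
    sym     : ∀ i j k → col i j k ≡ col j i k
    regular : ∀ c v → deg col c v ≡ r
open Factorization public

Adj : ∀ {n lam q} → Colouring n lam q → Fin q → Fin n → Fin n → Set
Adj col c u w = u ≢ w × ∃ λ k → col u w k ≡ c

data Reach {n lam q} (col : Colouring n lam q) (c : Fin q) : Fin n → Fin n → Set where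
  here : ∀ {u} → Reach col c u u
  step : ∀ {u w v} → Adj col c u w → Reach col c w v → Reach col c u v

Connected : ∀ {n lam r} → Factorization n lam r → Set
Connected {n} F = ∀ c (u v : Fin n) → Reach (col F) c u v

Extends : ∀ {m n lam r} (s : ℕ) → m ≤ n → Factorization m lam r → Set
Extends {m} {n} {lam} s m≤n F =
  Σ (Factorization n lam s) λ G → Connected G ×
    Σ (Fin (q F) → Fin (q G)) λ φ → Injective _≡_ _≡_ φ ×
      (∀ (i j : Fin m) (k : Fin lam) → i ≢ j →
         col G (inject≤ i m≤n) (inject≤ j m≤n) k ≡ φ (col F i j k))

Admissible : ℕ → ℕ → ℕ → Set
Admissible n r lam = (2 ∣ r * n) × (r ∣ lam * (n ∸ 1))

{-# OPTIONS --safe #-}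
module Submission where

open import Defs hiding (q; col; sym; regular; here)
open import Data.Bool using (Bool; true; false; _∧_; _∨_; not; if_then_else_)
import Data.Bool.Properties as Bool
open import Data.Bool.Properties using (∧-zeroʳ; ∧-identityʳ)
open import Data.Fin using (Fin; zero; suc; toℕ; fromℕ<; inject≤)
import Data.Fin.Properties as Fin
open import Data.List using (List; []; _∷_; _++_; map; length; filter; tabulate; allFin; cartesianProduct)
open import Data.List.Properties using (length-tabulate)
open import Data.List.Membership.Propositional using (_∈_)
open import Data.List.Membership.Propositional.Properties using (∈-allFin)
open import Data.List.Relation.Unary.Any using (here; there)
open import Data.Maybe using (Maybe; just; nothing)
open import Data.Nat using (ℕ; zero; suc; _+_; _*_; _∸_; _≤_; _<_; z≤n; s≤s; z<s; s≤s⁻¹; _≤?_; _<?_; NonZero; >-nonZero)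
open import Data.Nat.Divisibility using (_∣_; divides; ∣m+n∣m⇒∣n)
open import Data.Nat.Properties hiding (_≟_)
open import Data.Nat.Tactic.RingSolver using (solve-∀)
open import Data.Product using (Σ; ∃; _×_; _,_; proj₁; proj₂)
open import Data.Sum using (_⊎_; inj₁; inj₂)
open import Function using (_∘_; id)
open import Function.Bundles using (_⇔_; mk⇔)
open import Function.Definitions using (Injective)
open import Relation.Binary using (DecidableEquality; tri<; tri≈; tri>)
open import Relation.Binary.Construct.Closure.ReflexiveTransitive using (Star; ε; _◅_; _◅◅_)
open import Relation.Binary.PropositionalEquality
open import Relation.Nullary using (¬_; Dec; yes; no; does; ¬?; contradiction)
open import Relation.Nullary.Decidable using (dec-true; dec-false; map′; _×-dec_; _⊎-dec_)

-- Sufficiency.  Call the vertices of λK_m old and the others new.  Exchanging the colours of the k-th edges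
-- xw and yw, for two new vertices x ≠ y and all (w , k) in a set S of slots, alters no other degree and no edge
-- between old vertices.  The slots form a directed multigraph on the colours (an arrow from the colour of xw to that
-- of yw), and S is always a trail in it.
--
-- 1. Colour the edges at the new vertices so that each old vertex has degree s in every colour and the degrees of
--    every colour add up to sn; (ii), (iii) and the parities in (i) make this possible.
-- 2. While some degree exceeds s, a trail exchange makes the degrees at two new vertices more equal.
-- 3. If colour c is disconnected, its component of a fixed new vertex contains a new vertex x with two c-edges on a
--    common cycle: every old vertex has a c-edge to a new one, so walking away from a cut vertex cannot go on
--    forever.  Let y be a new vertex in another component.  Exchange along a trail that uses exactly one of these
--    two edges; then x and y become connected.  For each colour d joining x to y, choose a d-path
--    x z … w y and make the trail use the slots of xz and yw together or not at all: then d still joins x to y, and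
--    no connected colour is lost.
--
-- Necessity is counting: factors, degrees (for parity), edges leaving the old vertices, and the edges at old
-- vertices in a colour that does not occur on λK_m.

-- A count makes the first colouring possible. Let `ρ c` be r for the colours of the given factors
-- and 0 for the others. An old vertex needs s - ρ(c) edges of colour c to the new ones, and a
-- degree sum of sn then leaves ns - 2ms + mρ(c) for twice the number of c-edges among the new
-- vertices. This is even by (i). It is nonnegative if n ≥ 2m; otherwise (ii) is an equality, every
-- colour comes from a given factor, and the bound follows from n > m. That these quotas add up to
-- the numbers of available edges follows from the numbers of factors, λ(m-1)/r and λ(n-1)/s.
--
-- The obstacle afterwards is that an exchange along a trail affects many colours at once. Degrees
-- stay under control, since they can change only in the two end colours of the trail. Connectivity
-- does not, so in step 3 each colour, as a vertex of the directed multigraph, is split into two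
-- halves. A half with one arrow in and one arrow out forces the trail to use both or neither, and a
-- half of c that is a sink keeps the trail from leaving c a second time.

-- Finite sums.

∑ : ∀ {A : Set} → List A → (A → ℕ) → ℕ
∑ []       f = 0
∑ (x ∷ xs) f = f x + ∑ xs f

interchange : ∀ a b c d → (a + b) + (c + d) ≡ (a + c) + (b + d)
interchange = solve-∀

*-left-comm : ∀ a b c → a * (b * c) ≡ b * (a * c)
*-left-comm = solve-∀

module _ {A : Set} where

  ∑-cong : ∀ (xs : List A) {f g} → (∀ x → f x ≡ g x) → ∑ xs f ≡ ∑ xs g
  ∑-cong []       f≗g = refl
  ∑-cong (x ∷ xs) f≗g = cong₂ _+_ (f≗g x) (∑-cong xs f≗g)

  ∑-+ : ∀ (xs : List A) f g → ∑ xs (λ x → f x + g x) ≡ ∑ xs f + ∑ xs g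
  ∑-+ []       f g = refl
  ∑-+ (x ∷ xs) f g =
    trans (cong (f x + g x +_) (∑-+ xs f g)) (interchange (f x) (g x) (∑ xs f) (∑ xs g))

  ∑-*ˡ : ∀ (xs : List A) k f → ∑ xs (λ x → k * f x) ≡ k * ∑ xs f
  ∑-*ˡ []       k f = sym (*-zeroʳ k)
  ∑-*ˡ (x ∷ xs) k f = trans (cong (k * f x +_) (∑-*ˡ xs k f)) (sym (*-distribˡ-+ k (f x) (∑ xs f)))

  ∑-*ʳ : ∀ (xs : List A) k f → ∑ xs (λ x → f x * k) ≡ ∑ xs f * k
  ∑-*ʳ xs k f = trans (∑-cong xs λ x → *-comm (f x) k) (trans (∑-*ˡ xs k f) (*-comm k _))

  ∑-const : ∀ (xs : List A) k → ∑ xs (λ _ → k) ≡ length xs * k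
  ∑-const []       k = refl
  ∑-const (x ∷ xs) k = cong (k +_) (∑-const xs k)

  ∑-zero : ∀ (xs : List A) {f} → (∀ x → f x ≡ 0) → ∑ xs f ≡ 0
  ∑-zero xs f≗0 = trans (∑-cong xs f≗0) (trans (∑-const xs 0) (*-zeroʳ (length xs)))

  ∑-mono : ∀ (xs : List A) {f g} → (∀ x → f x ≤ g x) → ∑ xs f ≤ ∑ xs g
  ∑-mono []       f≤g = z≤n
  ∑-mono (x ∷ xs) f≤g = +-mono-≤ (f≤g x) (∑-mono xs f≤g)

  ∑-<⇒∃< : ∀ (xs : List A) {f g} → ∑ xs f < ∑ xs g → ∃ λ x → f x < g x
  ∑-<⇒∃< (x ∷ xs) {f} {g} lt with f x <? g x
  ... | yes fx<gx = x , fx<gx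
  ... | no  fx≮gx = ∑-<⇒∃< xs (+-cancelˡ-< (f x) _ _ (<-≤-trans lt (+-monoˡ-≤ _ (≮⇒≥ fx≮gx))))

  ∑-++ : ∀ (xs ys : List A) f → ∑ (xs ++ ys) f ≡ ∑ xs f + ∑ ys f
  ∑-++ []       ys f = refl
  ∑-++ (x ∷ xs) ys f = trans (cong (f x +_) (∑-++ xs ys f)) (sym (+-assoc (f x) _ _))

∑-map : ∀ {A B : Set} (h : A → B) xs f → ∑ (map h xs) f ≡ ∑ xs (f ∘ h)
∑-map h []       f = refl
∑-map h (x ∷ xs) f = cong (f (h x) +_) (∑-map h xs f)

module _ {A B : Set} where

  ∑-product : ∀ (xs : List A) (ys : List B) f →
    ∑ (cartesianProduct xs ys) f ≡ ∑ xs λ x → ∑ ys λ y → f (x , y)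
  ∑-product []       ys f = refl
  ∑-product (x ∷ xs) ys f =
    trans (∑-++ (map (λ y → x , y) ys) _ f) (cong₂ _+_ (∑-map (λ y → x , y) ys f) (∑-product xs ys f))

  ∑-swap : ∀ (xs : List A) (ys : List B) (f : A → B → ℕ) →
    ∑ xs (λ x → ∑ ys (f x)) ≡ ∑ ys λ y → ∑ xs λ x → f x y
  ∑-swap []       ys f = sym (∑-zero ys λ _ → refl)
  ∑-swap (x ∷ xs) ys f = trans (cong (∑ ys (f x) +_) (∑-swap xs ys f)) (sym (∑-+ ys (f x) _))

∑-tabulate : ∀ {A : Set} {n} (g : Fin n → A) f → ∑ (tabulate g) f ≡ ∑ (allFin n) (f ∘ g)
∑-tabulate {n = zero}  g f = refl
∑-tabulate {n = suc n} g f = cong (f (g zero) +_)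
  (trans (∑-tabulate (g ∘ suc) f) (sym (∑-tabulate suc (f ∘ g))))

∑-suc : ∀ n (f : Fin (suc n) → ℕ) → ∑ (allFin (suc n)) f ≡ f zero + ∑ (allFin n) (f ∘ suc)
∑-suc n f = cong (f zero +_) (∑-tabulate suc f)

-- Boolean indicators and counting in finite types.

⟦_⟧ : Bool → ℕ
⟦ true  ⟧ = 1
⟦ false ⟧ = 0

⟦∧⟧ : ∀ a b → ⟦ a ∧ b ⟧ ≡ ⟦ a ⟧ * ⟦ b ⟧
⟦∧⟧ true  b = sym (+-identityʳ ⟦ b ⟧)
⟦∧⟧ false b = refl

⟦⟧-injective : ∀ {a b} → ⟦ a ⟧ ≡ ⟦ b ⟧ → a ≡ b
⟦⟧-injective {true}  {true}  _ = refl
⟦⟧-injective {false} {false} _ = refl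

⟦⟧-mono : ∀ {a b} → (a ≡ true → b ≡ true) → ⟦ a ⟧ ≤ ⟦ b ⟧
⟦⟧-mono {false}     a⇒b = z≤n
⟦⟧-mono {true}  {b} a⇒b rewrite a⇒b refl = ≤-refl

⟦⟧-<⁻¹ : ∀ {a b} → ⟦ a ⟧ < ⟦ b ⟧ → a ≡ false × b ≡ true
⟦⟧-<⁻¹ {false} {true} _ = refl , refl
⟦⟧-<⁻¹ {true}  {true} (s≤s ())

bool-≡ : ∀ {a b} → (a ≡ true → b ≡ true) → (b ≡ true → a ≡ true) → a ≡ b
bool-≡ {true}          f g = sym (f refl)
bool-≡ {false} {true}  f g = g refl
bool-≡ {false} {false} f g = refl

∧-true : ∀ {a b} → a ∧ b ≡ true → a ≡ true × b ≡ true
∧-true {true} {true} _ = refl , refl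

does⁻¹ : ∀ {P : Set} (P? : Dec P) → does P? ≡ true → P
does⁻¹ (yes p) _ = p

does⁻¹-false : ∀ {P : Set} (P? : Dec P) → does P? ≡ false → ¬ P
does⁻¹-false (no ¬p) _ = ¬p

not⁻¹ : ∀ {b} → not b ≡ true → b ≡ false
not⁻¹ {false} _ = refl

true≢false : ∀ {b} → b ≡ true → ¬ b ≡ false
true≢false refl ()

length-filter-∑ : ∀ {A : Set} {P : A → Set} (P? : ∀ x → Dec (P x)) xs →
  length (filter P? xs) ≡ ∑ xs λ x → ⟦ does (P? x) ⟧
length-filter-∑ P? []       = refl
length-filter-∑ P? (x ∷ xs) with does (P? x)
... | true  = cong suc (length-filter-∑ P? xs)
... | false = length-filter-∑ P? xs

-- Completeness and absence of repetitions are one equation between sums, so that `elems` can be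
-- used in double counting without reasoning about list membership.
record Finite (A : Set) : Set where
  field
    _≟_   : DecidableEquality A
    elems : List A
    once  : ∀ j → ∑ elems (λ i → ⟦ does (i ≟ j) ⟧) ≡ 1

finite-Fin : ∀ n → Finite (Fin n)
finite-Fin n = record { _≟_ = Fin._≟_ ; elems = allFin n ; once = once n }
  where
  once : ∀ n (j : Fin n) → ∑ (allFin n) (λ i → ⟦ does (i Fin.≟ j) ⟧) ≡ 1
  once (suc n) zero    = trans (∑-suc n (λ i → ⟦ does (i Fin.≟ zero) ⟧)) (cong suc (∑-zero (allFin n) λ _ → refl))
  once (suc n) (suc j) = trans (∑-suc n (λ i → ⟦ does (i Fin.≟ suc j) ⟧)) (once n j)

infixr 4 _×-≟_
_×-≟_ : ∀ {A B : Set} → DecidableEquality A → DecidableEquality B → DecidableEquality (A × B)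
(_≟₁_ ×-≟ _≟₂_) (a , b) (c , d) =
  map′ (λ (p , q) → cong₂ _,_ p q) (λ e → cong proj₁ e , cong proj₂ e) ((a ≟₁ c) ×-dec (b ≟₂ d))

finite-× : ∀ {A B : Set} → Finite A → Finite B → Finite (A × B)
finite-× {A} {B} FA FB = record { _≟_ = A._≟_ ×-≟ B._≟_ ; elems = cartesianProduct A.elems B.elems ; once = once }
  where
  module A = Finite FA
  module B = Finite FB
  once : ∀ j → ∑ (cartesianProduct A.elems B.elems) (λ i → ⟦ does ((A._≟_ ×-≟ B._≟_) i j) ⟧) ≡ 1
  once (a , b) = begin
    _ ≡⟨ ∑-product A.elems B.elems _ ⟩
    _ ≡⟨ (∑-cong A.elems λ x → trans (∑-cong B.elems λ y → ⟦∧⟧ (does (x A.≟ a)) _)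
                                     (∑-*ˡ B.elems ⟦ does (x A.≟ a) ⟧ _)) ⟩
    _ ≡⟨ ∑-*ʳ A.elems _ _ ⟩
    _ ≡⟨ cong₂ _*_ (A.once a) (B.once b) ⟩
    1 ∎
    where open ≡-Reasoning

module Count {T : Set} (fin : Finite T) where
  open Finite fin

  ♯ : (T → Bool) → ℕ
  ♯ p = ∑ elems λ t → ⟦ p t ⟧

  ≟-refl : ∀ t → does (t ≟ t) ≡ true
  ≟-refl t = dec-true (t ≟ t) refl

  ∑-δ : ∀ j (f : T → ℕ) → ∑ elems (λ t → ⟦ does (t ≟ j) ⟧ * f t) ≡ f j
  ∑-δ j f = begin
    _ ≡⟨ ∑-cong elems pt ⟩
    _ ≡⟨ ∑-*ʳ elems (f j) _ ⟩
    _ ≡⟨ cong (_* f j) (once j) ⟩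
    _ ≡⟨ +-identityʳ (f j) ⟩
    f j ∎
    where
    open ≡-Reasoning
    pt : ∀ t → ⟦ does (t ≟ j) ⟧ * f t ≡ ⟦ does (t ≟ j) ⟧ * f j
    pt t with t ≟ j
    ... | yes refl = refl
    ... | no  _    = refl

  term≤∑ : ∀ (f : T → ℕ) j → f j ≤ ∑ elems f
  term≤∑ f j = ≤-trans (≤-reflexive (sym (∑-δ j f))) (∑-mono elems pt)
    where
    pt : ∀ t → ⟦ does (t ≟ j) ⟧ * f t ≤ f t
    pt t with does (t ≟ j)
    ... | true  = ≤-reflexive (+-identityʳ (f t))
    ... | false = z≤n

  ∑-mono-< : ∀ {f g : T → ℕ} → (∀ t → f t ≤ g t) → ∀ j → f j < g j → ∑ elems f < ∑ elems g
  ∑-mono-< {f} {g} f≤g j fj<gj = begin-strict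
    ∑ elems f                                    <⟨ n<1+n _ ⟩
    1 + ∑ elems f                                ≡⟨ cong (_+ ∑ elems f) (sym (once j)) ⟩
    ♯ (λ t → does (t ≟ j)) + ∑ elems f           ≡⟨ sym (∑-+ elems _ f) ⟩
    ∑ elems (λ t → ⟦ does (t ≟ j) ⟧ + f t)       ≤⟨ ∑-mono elems pt ⟩
    ∑ elems g                                    ∎
    where
    open ≤-Reasoning
    pt : ∀ t → ⟦ does (t ≟ j) ⟧ + f t ≤ g t
    pt t with t ≟ j
    ... | yes refl = fj<gj
    ... | no  _    = f≤g t

  ∑-≡⇒≗ : ∀ {f g : T → ℕ} → (∀ t → f t ≤ g t) → ∑ elems f ≡ ∑ elems g → ∀ t → f t ≡ g t
  ∑-≡⇒≗ f≤g eq t with m≤n⇒m<n∨m≡n (f≤g t)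
  ... | inj₁ lt = contradiction eq (<⇒≢ (∑-mono-< f≤g t lt))
  ... | inj₂ e  = e

  -- Meant for exchanges, which change degrees at two vertices only. The old and new values are
  -- added on opposite sides so that no truncated subtraction occurs.
  ∑-two-point : ∀ {f f′ : T → ℕ} {x y} → x ≢ y → (∀ t → t ≢ x → t ≢ y → f′ t ≡ f t) →
    ∑ elems f′ + (f x + f y) ≡ ∑ elems f + (f′ x + f′ y)
  ∑-two-point {f} {f′} {x} {y} x≢y same = begin
    ∑ elems f′ + (f x + f y)                         ≡⟨ cong (∑ elems f′ +_) (sym (two f)) ⟩
    ∑ elems f′ + ∑ elems (λ t → at x t * f t + at y t * f t) ≡⟨ sym (∑-+ elems f′ _) ⟩
    ∑ elems (λ t → f′ t + (at x t * f t + at y t * f t))  ≡⟨ ∑-cong elems pt ⟩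
    ∑ elems (λ t → f t + (at x t * f′ t + at y t * f′ t)) ≡⟨ ∑-+ elems f _ ⟩
    ∑ elems f + ∑ elems (λ t → at x t * f′ t + at y t * f′ t) ≡⟨ cong (∑ elems f +_) (two f′) ⟩
    ∑ elems f + (f′ x + f′ y) ∎
    where
    open ≡-Reasoning
    at : T → T → ℕ
    at j t = ⟦ does (t ≟ j) ⟧
    two : ∀ h → ∑ elems (λ t → at x t * h t + at y t * h t) ≡ h x + h y
    two h = trans (∑-+ elems _ _) (cong₂ _+_ (∑-δ x h) (∑-δ y h))
    pt : ∀ t → f′ t + (at x t * f t + at y t * f t) ≡ f t + (at x t * f′ t + at y t * f′ t)
    pt t with t ≟ x | t ≟ y
    ... | yes refl | yes refl = contradiction refl x≢y
    ... | yes refl | no _ = begin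
      f′ t + (f t + 0 + 0)  ≡⟨ arith (f′ t) (f t) ⟩
      f t + (f′ t + 0 + 0)  ∎
      where arith : ∀ a b → a + (b + 0 + 0) ≡ b + (a + 0 + 0)
            arith = solve-∀
    ... | no _ | yes refl = arith (f′ t) (f t)
      where arith : ∀ a b → a + (b + 0) ≡ b + (a + 0)
            arith = solve-∀
    ... | no t≢x | no t≢y = cong (_+ 0) (same t t≢x t≢y)

  ∑-two-point-≡ : ∀ {f f′ : T → ℕ} {x y} → x ≢ y → (∀ t → t ≢ x → t ≢ y → f′ t ≡ f t) →
    f′ x + f′ y ≡ f x + f y → ∑ elems f′ ≡ ∑ elems f
  ∑-two-point-≡ {f} {f′} {x} {y} x≢y same eq = +-cancelʳ-≡ (f x + f y) _ _
    (trans (∑-two-point x≢y same) (cong (∑ elems f +_) eq))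

  ∑-two-point-< : ∀ {f f′ : T → ℕ} {x y} → x ≢ y → (∀ t → t ≢ x → t ≢ y → f′ t ≡ f t) →
    f′ x + f′ y < f x + f y → ∑ elems f′ < ∑ elems f
  ∑-two-point-< {f} {f′} {x} {y} x≢y same lt = +-cancelʳ-< (f x + f y) _ _
    (subst (_< ∑ elems f + (f x + f y)) (sym (∑-two-point x≢y same)) (+-monoʳ-< (∑ elems f) lt))

  ♯-cong : ∀ {p q : T → Bool} → (∀ t → p t ≡ q t) → ♯ p ≡ ♯ q
  ♯-cong p≗q = ∑-cong elems λ t → cong ⟦_⟧ (p≗q t)

  ♯-none : ∀ {p : T → Bool} → (∀ t → p t ≡ false) → ♯ p ≡ 0
  ♯-none p≗f = ∑-zero elems λ t → cong ⟦_⟧ (p≗f t)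

  ♯-<⇒∃ : ∀ {p q : T → Bool} → ♯ p < ♯ q → ∃ λ t → p t ≡ false × q t ≡ true
  ♯-<⇒∃ lt with ∑-<⇒∃< elems lt
  ... | t , lt′ = t , ⟦⟧-<⁻¹ lt′

  ♯-pos : ∀ {p : T → Bool} → 0 < ♯ p → ∃ λ t → p t ≡ true
  ♯-pos {p} lt with ♯-<⇒∃ {λ _ → false} {p} (subst (_< ♯ p) (sym (♯-none λ _ → refl)) lt)
  ... | t , _ , pt = t , pt

  ♯-δ-∧ : ∀ j (p : T → Bool) → ♯ (λ t → does (t ≟ j) ∧ p t) ≡ ⟦ p j ⟧
  ♯-δ-∧ j p = trans (∑-cong elems λ t → ⟦∧⟧ (does (t ≟ j)) (p t)) (∑-δ j (λ t → ⟦ p t ⟧))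

  _∖_ : (T → Bool) → T → T → Bool
  (p ∖ j) t = p t ∧ not (does (t ≟ j))

  -- With `f` constantly true this is the decrease in size that drives the inductions; with `f` a
  -- colour test it updates a colour count.
  ♯-∖ : ∀ (p : T → Bool) j → p j ≡ true → ∀ (f : T → Bool) →
    ♯ (λ t → p t ∧ f t) ≡ ♯ (λ t → (p ∖ j) t ∧ f t) + ⟦ f j ⟧
  ♯-∖ p j pj f = begin
    ♯ (λ t → p t ∧ f t) ≡⟨ ∑-cong elems pt ⟩
    _ ≡⟨ ∑-+ elems _ _ ⟩
    ♯ (λ t → (p ∖ j) t ∧ f t) + ♯ (λ t → does (t ≟ j) ∧ f t) ≡⟨ cong (♯ (λ t → (p ∖ j) t ∧ f t) +_) (♯-δ-∧ j f) ⟩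
    ♯ (λ t → (p ∖ j) t ∧ f t) + ⟦ f j ⟧ ∎
    where
    open ≡-Reasoning
    pt : ∀ t → ⟦ p t ∧ f t ⟧ ≡ ⟦ (p ∖ j) t ∧ f t ⟧ + ⟦ does (t ≟ j) ∧ f t ⟧
    pt t with t ≟ j
    ... | yes refl rewrite pj = refl
    ... | no  _ rewrite ∧-identityʳ (p t) = sym (+-identityʳ _)

  second : ∀ {p : T → Bool} → 2 ≤ ♯ p → ∀ j → ∃ λ t → t ≢ j × p t ≡ true
  second {p} 2≤ j with p j in pj
  ... | false with ♯-pos (≤-trans (s≤s z≤n) 2≤)
  ...   | t , pt = t , (λ { refl → true≢false pt pj }) , pt
  second {p} 2≤ j | true with ♯-pos {p ∖ j} (+-cancelʳ-< 1 0 _ (subst (2 ≤_) e 2≤))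
    where
    e : ♯ p ≡ ♯ (p ∖ j) + 1
    e = trans (♯-cong λ t → sym (∧-identityʳ (p t)))
          (trans (♯-∖ p j pj (λ _ → true)) (cong (_+ 1) (♯-cong λ t → ∧-identityʳ _)))
  ... | t , h = t , does⁻¹-false (t ≟ j) (not⁻¹ (proj₂ (∧-true h))) , proj₁ (∧-true h)

-- Trails in a directed multigraph.

module Trail {T : Set} (fin : Finite T) {K : Set} (_≟ᴷ_ : DecidableEquality K) where
  open Finite fin
  open Count fin

  cnt : (T → Bool) → (T → K) → K → ℕ
  cnt p f g = ♯ λ t → p t ∧ does (f t ≟ᴷ g)

  [_≟_]ᴷ : K → K → ℕ
  [ g ≟ h ]ᴷ = ⟦ does (g ≟ᴷ h) ⟧

  -- Read t as an arrow from a t to b t: S is the set of arrows of a trail that starts at c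
  -- and stops on its first arrival at a vertex entered more often than left.
  record DirectedTrail (p : T → Bool) (a b : T → K) (c : K) : Set where
    field
      S        : T → Bool
      end      : K
      S⊆p      : ∀ t → S t ≡ true → p t ≡ true
      end-sink : cnt p a end < cnt p b end
      balance  : ∀ g → cnt S a g + [ end ≟ g ]ᴷ ≡ cnt S b g + [ c ≟ g ]ᴷ
      no-sink  : ∀ t → S t ≡ true → ¬ cnt p a (a t) < cnt p b (a t)

  [≟]-refl : ∀ g → [ g ≟ g ]ᴷ ≡ 1
  [≟]-refl g = cong ⟦_⟧ (dec-true (g ≟ᴷ g) refl)

  private
    -- Take any arrow `t` out of `c`. If it arrives at a sink, stop; otherwise delete it and
    -- continue from `b t`, which then has more departures than arrivals. `N` bounds the number of
    -- arrows left. Sinks are meant in the undiminished `p`, so both sink conditions have to be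
    -- carried back from `p ∖ t` to `p`.
    trail-fuel : ∀ N {p} {a b : T → K} {c} → ♯ p ≤ N → cnt p b c < cnt p a c → DirectedTrail p a b c
    trail-fuel zero {p} {a} {b} {c} ♯p≤0 lt = contradiction
      (≤-trans (s≤s z≤n) (≤-trans lt (≤-trans (∑-mono elems (λ t → ⟦⟧-mono (proj₁ ∘ ∧-true))) ♯p≤0))) λ ()
    trail-fuel (suc N) {p} {a} {b} {c} ♯p≤ lt with ♯-pos (≤-trans (s≤s z≤n) lt)
    ... | t , h with ∧-true {p t} h
    ...   | pt , at≟c with does⁻¹ (a t ≟ᴷ c) at≟c
    ...     | refl with cnt p a (b t) <? cnt p b (b t)
    ...       | yes sink = record
      { S = λ t′ → does (t′ ≟ t) ; end = b t ; end-sink = sink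
      ; S⊆p = λ t′ e → subst (λ z → p z ≡ true) (sym (does⁻¹ (t′ ≟ t) e)) pt
      ; balance = λ g → trans (cong (_+ [ b t ≟ g ]ᴷ) (♯-δ-∧ t _))
                    (trans (+-comm [ a t ≟ g ]ᴷ _) (cong (_+ [ a t ≟ g ]ᴷ) (sym (♯-δ-∧ t _))))
      ; no-sink = λ t′ e → subst (λ z → ¬ cnt p a (a z) < cnt p b (a z)) (sym (does⁻¹ (t′ ≟ t) e)) (<⇒≯ lt) }
    ...       | no ¬sink = record
      { S = S⁺ ; end = R.end ; S⊆p = S⁺⊆p ; end-sink = end-sink ; balance = balance ; no-sink = no-sink }
      where
      e = b t
      p′ = p ∖ t
      Ap : ∀ g → cnt p a g ≡ cnt p′ a g + [ a t ≟ g ]ᴷ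
      Ap g = ♯-∖ p t pt (λ t′ → does (a t′ ≟ᴷ g))
      Bp : ∀ g → cnt p b g ≡ cnt p′ b g + [ e ≟ g ]ᴷ
      Bp g = ♯-∖ p t pt (λ t′ → does (b t′ ≟ᴷ g))
      ♯p′ : ♯ p′ ≤ N
      ♯p′ = +-cancelʳ-≤ 1 _ _ (subst₂ _≤_
              (trans (♯-cong λ t → sym (∧-identityʳ (p t)))
                (trans (♯-∖ p t pt (λ _ → true)) (cong (_+ 1) (♯-cong λ t → ∧-identityʳ _))))
              (sym (+-comm N 1)) ♯p≤)
      -- If `t` is a loop, both counts at `c` drop by one and the surplus at `c` persists; otherwise
      -- `e`, not a sink, loses an arrival only.
      start : cnt p′ b e < cnt p′ a e
      start with a t ≟ᴷ e
      ... | yes a≡e = +-cancelʳ-< 1 _ _ (subst₂ _<_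
              (trans (Bp e) (cong (cnt p′ b e +_) ([≟]-refl e)))
              (trans (Ap e) (cong (cnt p′ a e +_) (cong ⟦_⟧ (dec-true (a t ≟ᴷ e) a≡e))))
              (subst (λ z → cnt p b z < cnt p a z) a≡e lt))
      ... | no a≢e = subst₂ _≤_
              (trans (Bp e) (trans (cong (cnt p′ b e +_) ([≟]-refl e)) (+-comm _ 1)))
              (trans (Ap e) (trans (cong (cnt p′ a e +_) (cong ⟦_⟧ (dec-false (a t ≟ᴷ e) a≢e))) (+-identityʳ _)))
              (≮⇒≥ ¬sink)
      R : DirectedTrail p′ a b e
      R = trail-fuel N ♯p′ start
      module R = DirectedTrail R
      S⁺ : T → Bool
      S⁺ t′ = R.S t′ ∨ does (t′ ≟ t)
      S⁺-split : ∀ (f : T → Bool) → ♯ (λ t′ → S⁺ t′ ∧ f t′) ≡ ♯ (λ t′ → R.S t′ ∧ f t′) + ⟦ f t ⟧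
      S⁺-split f = trans (∑-cong elems pt-wise) (trans (∑-+ elems _ _) (cong (♯ (λ t′ → R.S t′ ∧ f t′) +_) (♯-δ-∧ t f)))
        where
        pt-wise : ∀ t′ → ⟦ S⁺ t′ ∧ f t′ ⟧ ≡ ⟦ R.S t′ ∧ f t′ ⟧ + ⟦ does (t′ ≟ t) ∧ f t′ ⟧
        pt-wise t′ with R.S t′ in St′ | t′ ≟ t
        ... | false | _     = refl
        ... | true  | no _  = sym (+-identityʳ _)
        ... | true  | yes refl = contradiction
                (trans (sym (proj₂ (∧-true (R.S⊆p t′ St′)))) (cong not (≟-refl t′))) λ ()
      S⁺⊆p : ∀ t′ → S⁺ t′ ≡ true → p t′ ≡ true
      S⁺⊆p t′ h with R.S t′ in St′
      ... | true  = proj₁ (∧-true (R.S⊆p t′ St′))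
      ... | false = subst (λ z → p z ≡ true) (sym (does⁻¹ (t′ ≟ t) h)) pt
      -- Restoring `t` could destroy the sink only by adding a departure at `c` without an arrival;
      -- but `c` has a surplus of departures in `p`, so it cannot have been a sink of `p ∖ t` then.
      end-sink : cnt p a R.end < cnt p b R.end
      end-sink with a t ≟ᴷ R.end
      ... | no a≢d = subst₂ _<_
              (sym (trans (Ap R.end) (trans (cong (cnt p′ a R.end +_) (cong ⟦_⟧ (dec-false (a t ≟ᴷ R.end) a≢d))) (+-identityʳ _))))
              (sym (Bp R.end)) (≤-trans R.end-sink (m≤m+n _ _))
      ... | yes a≡d with e ≟ᴷ R.end
      ...   | yes e≡d = subst₂ _<_
              (sym (trans (Ap R.end) (cong (cnt p′ a R.end +_) (cong ⟦_⟧ (dec-true (a t ≟ᴷ R.end) a≡d)))))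
              (sym (trans (Bp R.end) (cong (cnt p′ b R.end +_) (cong ⟦_⟧ (dec-true (e ≟ᴷ R.end) e≡d)))))
              (+-monoˡ-< 1 R.end-sink)
      ...   | no e≢d = contradiction R.end-sink (≤⇒≯ (+-cancelʳ-≤ 1 _ _ (subst₂ _≤_
              (trans (cong suc (trans (Bp R.end) (trans (cong (cnt p′ b R.end +_) (cong ⟦_⟧ (dec-false (e ≟ᴷ R.end) e≢d))) (+-identityʳ _)))) (+-comm 1 _))
              (trans (Ap R.end) (cong (cnt p′ a R.end +_) (cong ⟦_⟧ (dec-true (a t ≟ᴷ R.end) a≡d))))
              (subst (λ z → cnt p b z < cnt p a z) a≡d lt))))
      balance : ∀ g → cnt S⁺ a g + [ R.end ≟ g ]ᴷ ≡ cnt S⁺ b g + [ a t ≟ g ]ᴷ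
      balance g = begin
        cnt S⁺ a g + [ R.end ≟ g ]ᴷ ≡⟨ cong (_+ [ R.end ≟ g ]ᴷ) (S⁺-split _) ⟩
        cnt R.S a g + [ a t ≟ g ]ᴷ + [ R.end ≟ g ]ᴷ ≡⟨ swapʳ (cnt R.S a g) _ _ ⟩
        cnt R.S a g + [ R.end ≟ g ]ᴷ + [ a t ≟ g ]ᴷ ≡⟨ cong (_+ [ a t ≟ g ]ᴷ) (R.balance g) ⟩
        cnt R.S b g + [ e ≟ g ]ᴷ + [ a t ≟ g ]ᴷ ≡⟨ cong (_+ [ a t ≟ g ]ᴷ) (sym (S⁺-split _)) ⟩
        cnt S⁺ b g + [ a t ≟ g ]ᴷ ∎
        where
        open ≡-Reasoning
        swapʳ : ∀ x y z → x + y + z ≡ x + z + y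
        swapʳ = solve-∀
      -- A sink of `p` is neither `a t`, which has a surplus of departures, nor `e`, so deleting `t`
      -- does not touch its counts.
      sink′ : ∀ g → cnt p a g < cnt p b g → cnt p′ a g < cnt p′ b g
      sink′ g sg = subst₂ _<_
        (trans (Ap g) (trans (cong (cnt p′ a g +_) (cong ⟦_⟧ (dec-false (a t ≟ᴷ g) λ { refl → <⇒≯ lt sg }))) (+-identityʳ _)))
        (trans (Bp g) (trans (cong (cnt p′ b g +_) (cong ⟦_⟧ (dec-false (e ≟ᴷ g) λ { refl → ¬sink sg }))) (+-identityʳ _)))
        sg
      no-sink : ∀ t′ → S⁺ t′ ≡ true → ¬ cnt p a (a t′) < cnt p b (a t′)
      no-sink t′ h with R.S t′ in St′
      ... | true  = R.no-sink t′ St′ ∘ sink′ (a t′)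
      ... | false = subst (λ z → ¬ cnt p a (a z) < cnt p b (a z)) (sym (does⁻¹ (t′ ≟ t) h)) (<⇒≯ lt)

  abstract
    trail : ∀ {p} {a b : T → K} {c} → cnt p b c < cnt p a c → DirectedTrail p a b c
    trail = trail-fuel _ ≤-refl

-- Splitting colours in order to steer a trail.

module Marking {T : Set} (fin : Finite T) {C : Set} (_≟ᶜ_ : DecidableEquality C) where
  open Finite fin
  open Count fin
  open Trail fin _≟ᶜ_ using (cnt)
  open Trail fin (_≟ᶜ_ ×-≟ Bool._≟_) renaming (cnt to cnt₂) hiding ([_≟_]ᴷ; [≟]-refl)

  is : Maybe T → T → Bool
  is nothing  t = false
  is (just s) t = does (t ≟ s)

  -- Each colour d is split in two: (d , true) is the colour of the slot selected by m d.
  mark : (C → Maybe T) → (T → C) → T → C × Bool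
  mark m f t = f t , is (m (f t)) t

  -- The half `(d , true)` is carried by the slot `s` alone.
  cnt-mark-just : ∀ q (m : C → Maybe T) f {d s} → m d ≡ just s → f s ≡ d →
    cnt₂ q (mark m f) (d , true) ≡ ⟦ q s ⟧
  cnt-mark-just q m f {d} {s} md≡s fs≡d = trans (♯-cong pt) (♯-δ-∧ s q)
    where
    fwd : ∀ t → q t ∧ (does (f t ≟ᶜ d) ∧ does (is (m (f t)) t Bool.≟ true)) ≡ true → does (t ≟ s) ∧ q t ≡ true
    fwd t h with ∧-true h
    ... | qt , h′ with ∧-true {does (f t ≟ᶜ d)} h′
    ...   | ft , h″ with does⁻¹ (f t ≟ᶜ d) ft | does⁻¹ (is (m (f t)) t Bool.≟ true) h″
    ...     | refl | sel = cong₂ _∧_ (trans (sym (cong (λ z → is z t) md≡s)) sel) qt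
    bwd : ∀ t → does (t ≟ s) ∧ q t ≡ true → q t ∧ (does (f t ≟ᶜ d) ∧ does (is (m (f t)) t Bool.≟ true)) ≡ true
    bwd t h with ∧-true h
    ... | t≟s , qt with does⁻¹ (t ≟ s) t≟s
    ...   | refl = cong₂ _∧_ qt (cong₂ _∧_ (dec-true (f t ≟ᶜ d) fs≡d)
                (dec-true (is (m (f t)) t Bool.≟ true)
                  (trans (cong (λ z → is (m z) t) fs≡d) (trans (cong (λ z → is z t) md≡s) (≟-refl t)))))
    pt : ∀ t → _
    pt t = bool-≡ (fwd t) (bwd t)

  cnt-mark-nothing : ∀ q (m : C → Maybe T) f {d} → m d ≡ nothing → cnt₂ q (mark m f) (d , true) ≡ 0
  cnt-mark-nothing q m f {d} md≡n = ♯-none pt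
    where
    pt : ∀ t → q t ∧ (does (f t ≟ᶜ d) ∧ does (is (m (f t)) t Bool.≟ true)) ≡ false
    pt t with f t ≟ᶜ d
    ... | no _     = ∧-zeroʳ (q t)
    ... | yes refl rewrite md≡n = ∧-zeroʳ (q t)

  cnt-mark-split : ∀ q (m : C → Maybe T) f d →
    cnt₂ q (mark m f) (d , true) + cnt₂ q (mark m f) (d , false) ≡ cnt q f d
  cnt-mark-split q m f d = sym (trans (∑-cong elems pt) (∑-+ elems _ _))
    where
    pt : ∀ t → ⟦ q t ∧ does (f t ≟ᶜ d) ⟧ ≡
      ⟦ q t ∧ (does (f t ≟ᶜ d) ∧ does (is (m (f t)) t Bool.≟ true)) ⟧ +
      ⟦ q t ∧ (does (f t ≟ᶜ d) ∧ does (is (m (f t)) t Bool.≟ false)) ⟧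
    pt t with q t | does (f t ≟ᶜ d) | is (m (f t)) t
    ... | false | _     | _     = refl
    ... | true  | false | _     = refl
    ... | true  | true  | true  = refl
    ... | true  | true  | false = refl

  -- As arrows, `t` leaves `d` and `u` enters `d`; they will be the end edges, at x and at y, of a
  -- path of colour `d`.
  Pairing : (T → Bool) → (T → C) → (T → C) → (C → Maybe (T × T)) → Set
  Pairing p a b pair = ∀ d t u → pair d ≡ just (t , u) → (p t ≡ true × a t ≡ d) × (p u ≡ true × b u ≡ d)

  -- `balanced` preserves all degrees. `S-z` and `S-only` move exactly one of the edges of colour
  -- `c` that x sends to third vertices, and `S-pair` protects the paths of the other colours.
  record Exchange (p : T → Bool) (a b : T → C) (c : C) (z : T) (pair : C → Maybe (T × T)) : Set where
    field
      S        : T → Bool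
      S⊆p      : ∀ t → S t ≡ true → p t ≡ true
      balanced : ∀ d → cnt S a d ≡ cnt S b d
      S-z      : S z ≡ true
      S-only   : ∀ t → p t ≡ true → a t ≡ c → t ≢ z → S t ≡ false
      S-pair   : ∀ d t u → d ≢ c → pair d ≡ just (t , u) → S t ≡ S u

  private
    -- Marking `z` on the side of `a` and nothing on the side of `b` gives `(c , true)` one
    -- departure and no arrival, which makes `(c , false)` a sink. All halves of other colours are
    -- balanced, so a trail from `(c , true)` must start with `z` and end at `(c , false)`; as it
    -- never leaves a sink, it uses no other arrow out of `c`. For a paired `d ≠ c` the half
    -- `(d , true)` has one arrow in and one out, so the trail uses both or neither.
    exchange-by-trail : ∀ {p} {a b : T → C} {c z pair} → p z ≡ true → a z ≡ c →
      (∀ d → cnt p a d ≡ cnt p b d) → Pairing p a b pair → Exchange p a b c z pair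
    exchange-by-trail {p} {a} {b} {c} {z} {pair} pz az≡c bal pairing = record
      { S = R.S ; S⊆p = R.S⊆p ; balanced = balanced ; S-z = S-z ; S-only = S-only ; S-pair = S-pair }
      where
      select : (T × T → T) → Maybe (T × T) → Maybe T
      select π (just tu) = just (π tu)
      select π nothing   = nothing

      mˣ mʸ : C → Maybe T
      mˣ d = if does (d ≟ᶜ c) then just z else select proj₁ (pair d)
      mʸ d = if does (d ≟ᶜ c) then nothing else select proj₂ (pair d)

      mˣ-c : mˣ c ≡ just z
      mˣ-c rewrite dec-true (c ≟ᶜ c) refl = refl
      mʸ-c : mʸ c ≡ nothing
      mʸ-c rewrite dec-true (c ≟ᶜ c) refl = refl
      mˣ-d : ∀ {d} → d ≢ c → mˣ d ≡ select proj₁ (pair d)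
      mˣ-d {d} d≢c rewrite dec-false (d ≟ᶜ c) d≢c = refl
      mʸ-d : ∀ {d} → d ≢ c → mʸ d ≡ select proj₂ (pair d)
      mʸ-d {d} d≢c rewrite dec-false (d ≟ᶜ c) d≢c = refl

      a′ b′ : T → C × Bool
      a′ = mark mˣ a
      b′ = mark mʸ b

      A-c : ∀ q → cnt₂ q a′ (c , true) ≡ ⟦ q z ⟧
      A-c q = cnt-mark-just q mˣ a mˣ-c az≡c
      B-c : ∀ q → cnt₂ q b′ (c , true) ≡ 0
      B-c q = cnt-mark-nothing q mʸ b mʸ-c

      pair-eq : ∀ {d} → d ≢ c → cnt₂ p a′ (d , true) ≡ cnt₂ p b′ (d , true)
      pair-eq {d} d≢c with pair d in eq
      ... | nothing = trans (cnt-mark-nothing p mˣ a (trans (mˣ-d d≢c) (cong (select proj₁) eq)))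
                        (sym (cnt-mark-nothing p mʸ b (trans (mʸ-d d≢c) (cong (select proj₂) eq))))
      ... | just (t , u) with pairing d t u eq
      ...   | (pt , at) , (pu , bu) =
        trans (cnt-mark-just p mˣ a (trans (mˣ-d d≢c) (cong (select proj₁) eq)) at)
          (trans (cong ⟦_⟧ (trans pt (sym pu)))
            (sym (cnt-mark-just p mʸ b (trans (mʸ-d d≢c) (cong (select proj₂) eq)) bu)))

      rest-eq : ∀ {d} → d ≢ c → cnt₂ p a′ (d , false) ≡ cnt₂ p b′ (d , false)
      rest-eq {d} d≢c = +-cancelˡ-≡ (cnt₂ p b′ (d , true)) _ _
        (trans (cong (_+ cnt₂ p a′ (d , false)) (sym (pair-eq d≢c)))
          (trans (cnt-mark-split p mˣ a d) (trans (bal d) (sym (cnt-mark-split p mʸ b d)))))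

      start : cnt₂ p b′ (c , true) < cnt₂ p a′ (c , true)
      start = subst₂ _<_ (sym (B-c p)) (sym (trans (A-c p) (cong ⟦_⟧ pz))) z<s

      c-sink : cnt₂ p a′ (c , false) < cnt₂ p b′ (c , false)
      c-sink = ≤-reflexive (begin
        suc (cnt₂ p a′ (c , false))                        ≡⟨ cong (_+ cnt₂ p a′ (c , false)) (sym (trans (A-c p) (cong ⟦_⟧ pz))) ⟩
        cnt₂ p a′ (c , true) + cnt₂ p a′ (c , false)       ≡⟨ cnt-mark-split p mˣ a c ⟩
        cnt p a c                                          ≡⟨ bal c ⟩
        cnt p b c                                          ≡⟨ sym (cnt-mark-split p mʸ b c) ⟩
        cnt₂ p b′ (c , true) + cnt₂ p b′ (c , false)       ≡⟨ cong (_+ cnt₂ p b′ (c , false)) (B-c p) ⟩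
        cnt₂ p b′ (c , false)                              ∎)
        where open ≡-Reasoning

      R : DirectedTrail p a′ b′ (c , true)
      R = trail start
      module R = DirectedTrail R

      end≡ : ∀ {e} → R.end ≡ e → cnt₂ p a′ e < cnt₂ p b′ e
      end≡ refl = R.end-sink

      end-c : R.end ≡ (c , false)
      end-c with R.end in eq
      ... | d , β with d ≟ᶜ c
      end-c | .c , true  | yes refl = contradiction (end≡ eq) (<⇒≯ start)
      end-c | .c , false | yes refl = refl
      end-c | d  , true  | no d≢c   = contradiction (pair-eq d≢c) (<⇒≢ (end≡ eq))
      end-c | d  , false | no d≢c   = contradiction (rest-eq d≢c) (<⇒≢ (end≡ eq))

      S-balance : ∀ g → cnt₂ R.S a′ g + ⟦ does ((_≟ᶜ_ ×-≟ Bool._≟_) (c , false) g) ⟧ ≡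
                        cnt₂ R.S b′ g + ⟦ does ((_≟ᶜ_ ×-≟ Bool._≟_) (c , true) g) ⟧
      S-balance g = subst (λ e → cnt₂ R.S a′ g + ⟦ does ((_≟ᶜ_ ×-≟ Bool._≟_) e g) ⟧ ≡ cnt₂ R.S b′ g + ⟦ does ((_≟ᶜ_ ×-≟ Bool._≟_) (c , true) g) ⟧) end-c (R.balance g)

      -- Start and end are the two halves of `c`; merging the halves closes the trail.
      balanced : ∀ d → cnt R.S a d ≡ cnt R.S b d
      balanced d = +-cancelʳ-≡ (⟦ does (c ≟ᶜ d) ⟧) _ _ (begin
        cnt R.S a d + ⟦ does (c ≟ᶜ d) ⟧  ≡⟨ cong₂ _+_ (sym (cnt-mark-split R.S mˣ a d)) (sym (cong ⟦_⟧ (∧-identityʳ _))) ⟩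
        (At + Af) + ⟦ does (c ≟ᶜ d) ∧ true ⟧ ≡⟨ arith₁ At Af _ ⟩
        (At + 0) + (Af + ⟦ does (c ≟ᶜ d) ∧ true ⟧) ≡⟨ cong₂ _+_ (trans (cong (λ z → At + ⟦ z ⟧) (sym (∧-zeroʳ (does (c ≟ᶜ d))))) (S-balance (d , true))) (S-balance (d , false)) ⟩
        (Bt + ⟦ does (c ≟ᶜ d) ∧ true ⟧) + (Bf + ⟦ does (c ≟ᶜ d) ∧ false ⟧) ≡⟨ cong (λ z → Bt + ⟦ does (c ≟ᶜ d) ∧ true ⟧ + (Bf + ⟦ z ⟧)) (∧-zeroʳ (does (c ≟ᶜ d))) ⟩
        (Bt + ⟦ does (c ≟ᶜ d) ∧ true ⟧) + (Bf + 0) ≡⟨ arith₂ Bt Bf _ ⟩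
        (Bt + Bf) + ⟦ does (c ≟ᶜ d) ∧ true ⟧ ≡⟨ cong₂ _+_ (cnt-mark-split R.S mʸ b d) (cong ⟦_⟧ (∧-identityʳ _)) ⟩
        cnt R.S b d + ⟦ does (c ≟ᶜ d) ⟧ ∎)
        where
        open ≡-Reasoning
        At = cnt₂ R.S a′ (d , true)
        Af = cnt₂ R.S a′ (d , false)
        Bt = cnt₂ R.S b′ (d , true)
        Bf = cnt₂ R.S b′ (d , false)
        arith₁ : ∀ x y i → (x + y) + i ≡ (x + 0) + (y + i)
        arith₁ = solve-∀
        arith₂ : ∀ x y i → (x + i) + (y + 0) ≡ (x + y) + i
        arith₂ = solve-∀

      S-z : R.S z ≡ true
      S-z = ⟦⟧-injective (begin
        ⟦ R.S z ⟧                              ≡⟨ sym (A-c R.S) ⟩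
        cnt₂ R.S a′ (c , true)                 ≡⟨ sym (+-identityʳ _) ⟩
        cnt₂ R.S a′ (c , true) + 0             ≡⟨ cong (λ v → cnt₂ R.S a′ (c , true) + ⟦ v ⟧) (sym (∧-zeroʳ (does (c ≟ᶜ c)))) ⟩
        _                                      ≡⟨ S-balance (c , true) ⟩
        _                                      ≡⟨ cong₂ _+_ (B-c R.S) (cong (λ v → ⟦ v ∧ true ⟧) (dec-true (c ≟ᶜ c) refl)) ⟩
        1                                      ∎)
        where open ≡-Reasoning

      S-only : ∀ t → p t ≡ true → a t ≡ c → t ≢ z → R.S t ≡ false
      S-only t pt at≡c t≢z with R.S t in eq
      ... | false = refl
      ... | true  = contradiction (subst (λ e → cnt₂ p a′ e < cnt₂ p b′ e) (sym key) c-sink) (R.no-sink t eq)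
        where
        key : a′ t ≡ (c , false)
        key = cong₂ _,_ at≡c (trans (cong (λ d → is (mˣ d) t) at≡c)
                (trans (cong (λ m → is m t) mˣ-c) (dec-false (t ≟ z) t≢z)))

      S-pair : ∀ d t u → d ≢ c → pair d ≡ just (t , u) → R.S t ≡ R.S u
      S-pair d t u d≢c eq with pairing d t u eq
      ... | (pt , at) , (pu , bu) = ⟦⟧-injective (begin
        ⟦ R.S t ⟧                    ≡⟨ sym (cnt-mark-just R.S mˣ a (trans (mˣ-d d≢c) (cong (select proj₁) eq)) at) ⟩
        cnt₂ R.S a′ (d , true)       ≡⟨ +-cancelʳ-≡ 0 _ _ (subst₂ (λ v w → cnt₂ R.S a′ (d , true) + ⟦ v ⟧ ≡ cnt₂ R.S b′ (d , true) + ⟦ w ⟧)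
                                          (c≟d false) (c≟d true) (S-balance (d , true))) ⟩
        cnt₂ R.S b′ (d , true)       ≡⟨ cnt-mark-just R.S mʸ b (trans (mʸ-d d≢c) (cong (select proj₂) eq)) bu ⟩
        ⟦ R.S u ⟧                    ∎)
        where
        open ≡-Reasoning
        c≟d : ∀ β → does ((_≟ᶜ_ ×-≟ Bool._≟_) (c , β) (d , true)) ≡ false
        c≟d β = cong (_∧ does (β Bool.≟ true)) (dec-false (c ≟ᶜ d) (d≢c ∘ sym))

  abstract
    exchange : ∀ {p} {a b : T → C} {c z pair} → p z ≡ true → a z ≡ c →
      (∀ d → cnt p a d ≡ cnt p b d) → Pairing p a b pair → Exchange p a b c z pair
    exchange = exchange-by-trail

-- Decidable reachability.

module Reachability {T : Set} (fin : Finite T) {R : T → T → Set} (R? : ∀ u v → Dec (R u v)) where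
  open Finite fin

  -- Warshall's recursion: paths whose inner vertices lie in the list. It makes decidability a
  -- structural induction.
  Via : List T → T → T → Set
  Via []       u v = u ≡ v ⊎ R u v
  Via (w ∷ ws) u v = Via ws u v ⊎ (Via ws u w × Via ws w v)

  via? : ∀ ws u v → Dec (Via ws u v)
  via? []       u v = (u ≟ v) ⊎-dec R? u v
  via? (w ∷ ws) u v = via? ws u v ⊎-dec (via? ws u w ×-dec via? ws w v)

  -- If both paths pass through the head of the list, the detour between the first visit and the
  -- last one is dropped.
  via-trans : ∀ {ws u w v} → w ∈ ws → Via ws u w → Via ws w v → Via ws u v
  via-trans (here refl) p q = inj₂ (first p , last q)
    where
    first : ∀ {ws u w} → Via ws u w ⊎ (Via ws u w × Via ws w w) → Via ws u w
    first (inj₁ p)       = p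
    first (inj₂ (p , _)) = p
    last : ∀ {ws w v} → Via ws w v ⊎ (Via ws w w × Via ws w v) → Via ws w v
    last (inj₁ q)       = q
    last (inj₂ (_ , q)) = q
  via-trans (there w∈) (inj₁ p)        (inj₁ q)        = inj₁ (via-trans w∈ p q)
  via-trans (there w∈) (inj₁ p)        (inj₂ (q , q′)) = inj₂ (via-trans w∈ p q , q′)
  via-trans (there w∈) (inj₂ (p , p′)) (inj₁ q)        = inj₂ (p , via-trans w∈ p′ q)
  via-trans (there w∈) (inj₂ (p , _))  (inj₂ (_ , q′)) = inj₂ (p , q′)

  via-base : ∀ ws {u v} → u ≡ v ⊎ R u v → Via ws u v
  via-base []       r = r
  via-base (_ ∷ ws) r = inj₁ (via-base ws r)

  via⇒star : ∀ ws {u v} → Via ws u v → Star R u v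
  via⇒star []       (inj₁ refl)    = ε
  via⇒star []       (inj₂ r)       = r ◅ ε
  via⇒star (_ ∷ ws) (inj₁ p)       = via⇒star ws p
  via⇒star (_ ∷ ws) (inj₂ (p , q)) = via⇒star ws p ◅◅ via⇒star ws q

  ∈-elems : ∀ j → j ∈ elems
  ∈-elems j = go elems (subst (0 <_) (sym (once j)) z<s)
    where
    go : ∀ xs → 0 < ∑ xs (λ i → ⟦ does (i ≟ j) ⟧) → j ∈ xs
    go (x ∷ xs) pos with x ≟ j
    ... | yes refl = here refl
    ... | no  _    = there (go xs pos)

  star⇒via : ∀ {u v} → Star R u v → Via elems u v
  star⇒via ε        = via-base elems (inj₁ refl)
  star⇒via (r ◅ rs) = via-trans (∈-elems _) (via-base elems (inj₂ r)) (star⇒via rs)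

  star? : ∀ u v → Dec (Star R u v)
  star? u v = map′ (via⇒star elems) star⇒via (via? elems u v)

star-reverse : ∀ {T : Set} {R : T → T → Set} → (∀ {u v} → R u v → R v u) → ∀ {u v} → Star R u v → Star R v u
star-reverse R-sym ε        = ε
star-reverse R-sym (r ◅ rs) = star-reverse R-sym rs ◅◅ (R-sym r ◅ ε)

-- Degrees, and the exchange of colours at two vertices.

if-cong : ∀ {A : Set} {b b′} {x y : A} → b ≡ b′ → (if b then x else y) ≡ (if b′ then x else y)
if-cong refl = refl

if-true : ∀ {A : Set} {b} {x y : A} → b ≡ true → (if b then x else y) ≡ x
if-true refl = refl

if-false : ∀ {A : Set} {b} {x y : A} → b ≡ false → (if b then x else y) ≡ y
if-false refl = refl

module Degrees (n lam q : ℕ) where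

  Slot : Set
  Slot = Fin n × Fin lam

  slots : Finite Slot
  slots = finite-× (finite-Fin n) (finite-Fin lam)

  open Count slots public using (♯)
  open Trail slots {Fin q} Fin._≟_ public using (cnt)

  Col : Set
  Col = Colouring n lam q

  Symmetric : Col → Set
  Symmetric col = ∀ u v k → col u v k ≡ col v u k

  row : Col → Fin n → Slot → Fin q
  row col v (w , k) = col v w k

  degree : Col → Fin q → Fin n → ℕ
  degree col c v = ♯ λ (w , k) → not (does (w Fin.≟ v)) ∧ does (col v w k Fin.≟ c)

  deg≡degree : ∀ col c v → deg col c v ≡ degree col c v
  deg≡degree col c v = length-filter-∑ _ (Finite.elems slots)

  -- The slots in which x and y both have an edge to a third vertex; the edges xy are shared and
  -- never exchanged.
  off : Fin n → Fin n → Slot → Bool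
  off x y (w , k) = not (does (w Fin.≟ x)) ∧ not (does (w Fin.≟ y))

  off⁻¹ : ∀ {x y w k} → off x y (w , k) ≡ true → w ≢ x × w ≢ y
  off⁻¹ {x} {y} {w} h with ∧-true h
  ... | wx , wy = does⁻¹-false (w Fin.≟ x) (not⁻¹ wx) , does⁻¹-false (w Fin.≟ y) (not⁻¹ wy)

  off-intro : ∀ {x y w k} → w ≢ x → w ≢ y → off x y (w , k) ≡ true
  off-intro {x} {y} {w} w≢x w≢y = cong₂ (λ a b → not a ∧ not b) (dec-false (w Fin.≟ x) w≢x) (dec-false (w Fin.≟ y) w≢y)

  ∑-slots-at : ∀ y (f : Slot → ℕ) →
    ∑ (Finite.elems slots) (λ (w , k) → ⟦ does (w Fin.≟ y) ⟧ * f (w , k)) ≡ ∑ (allFin lam) λ k → f (y , k)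
  ∑-slots-at y f = begin
    _ ≡⟨ ∑-product (allFin n) (allFin lam) _ ⟩
    _ ≡⟨ ∑-cong (allFin n) (λ w → ∑-*ˡ (allFin lam) ⟦ does (w Fin.≟ y) ⟧ (λ k → f (w , k))) ⟩
    _ ≡⟨ Count.∑-δ (finite-Fin n) y (λ w → ∑ (allFin lam) λ k → f (w , k)) ⟩
    _ ∎
    where open ≡-Reasoning

  mult : Col → Fin q → Fin n → Fin n → ℕ
  mult col c x y = ∑ (allFin lam) λ k → ⟦ does (col x y k Fin.≟ c) ⟧

  -- Edges xy count equally at both ends. Comparing the degrees of x and y therefore amounts to
  -- comparing departures and arrivals in the multigraph on `off x y`.
  degree-off : ∀ col c {x y} → x ≢ y → degree col c x ≡ cnt (off x y) (row col x) c + mult col c x y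
  degree-off col c {x} {y} x≢y = begin
    degree col c x ≡⟨ ∑-cong (Finite.elems slots) pt ⟩
    _ ≡⟨ ∑-+ (Finite.elems slots) _ _ ⟩
    _ ≡⟨ cong (cnt (off x y) (row col x) c +_) (∑-slots-at y (λ (w , k) → ⟦ does (col x w k Fin.≟ c) ⟧)) ⟩
    _ ∎
    where
    open ≡-Reasoning
    pt : ∀ t → ⟦ not (does (proj₁ t Fin.≟ x)) ∧ does (row col x t Fin.≟ c) ⟧ ≡
      ⟦ off x y t ∧ does (row col x t Fin.≟ c) ⟧ + ⟦ does (proj₁ t Fin.≟ y) ⟧ * ⟦ does (row col x t Fin.≟ c) ⟧
    pt (w , k) with w Fin.≟ x | w Fin.≟ y
    ... | yes refl | yes refl = contradiction refl x≢y
    ... | yes refl | no _     = refl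
    ... | no _     | yes refl = sym (+-identityʳ _)
    ... | no _     | no _     = sym (+-identityʳ _)

  degree-off′ : ∀ col c {x y} → Symmetric col → x ≢ y →
    degree col c y ≡ cnt (off x y) (row col y) c + mult col c x y
  degree-off′ col c {x} {y} col-sym x≢y = trans (degree-off col c (x≢y ∘ sym)) (cong₂ _+_
    (Count.♯-cong slots λ (w , k) → cong (_∧ does (col y w k Fin.≟ c)) (Bool.∧-comm (not (does (w Fin.≟ y))) _))
    (∑-cong (allFin lam) λ k → cong (λ d → ⟦ does (d Fin.≟ c) ⟧) (col-sym y x k)))

  -- Stated for arbitrary rows, so that it serves x and, with the roles reversed, y.
  row-exchange : ∀ {x y} (S : Slot → Bool) (r r₁ r₂ : Slot → Fin q) →
    (∀ k → S (x , k) ≡ false) → (∀ k → S (y , k) ≡ false) → (∀ k → r (y , k) ≡ r₁ (y , k)) →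
    (∀ w k → w ≢ x → w ≢ y → r (w , k) ≡ (if S (w , k) then r₂ (w , k) else r₁ (w , k))) → ∀ c →
    ♯ (λ t → not (does (proj₁ t Fin.≟ x)) ∧ does (r t Fin.≟ c)) + cnt S r₁ c ≡
    ♯ (λ t → not (does (proj₁ t Fin.≟ x)) ∧ does (r₁ t Fin.≟ c)) + cnt S r₂ c
  row-exchange {x} {y} S r r₁ r₂ S-x S-y r-y r-off c =
    trans (sym (∑-+ (Finite.elems slots) _ _)) (trans (∑-cong (Finite.elems slots) pt) (∑-+ (Finite.elems slots) _ _))
    where
    ι : Fin q → ℕ
    ι d = ⟦ does (d Fin.≟ c) ⟧
    pt : ∀ t → ⟦ not (does (proj₁ t Fin.≟ x)) ∧ does (r t Fin.≟ c) ⟧ + ⟦ S t ∧ does (r₁ t Fin.≟ c) ⟧ ≡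
               ⟦ not (does (proj₁ t Fin.≟ x)) ∧ does (r₁ t Fin.≟ c) ⟧ + ⟦ S t ∧ does (r₂ t Fin.≟ c) ⟧
    pt (w , k) with w Fin.≟ x | w Fin.≟ y
    ... | yes refl | _        rewrite S-x k = refl
    ... | no _     | yes refl rewrite S-y k = cong (λ d → ι d + 0) (r-y k)
    ... | no w≢x   | no w≢y   with S (w , k) | r-off w k w≢x w≢y
    ...   | true  | e = trans (cong (λ d → ι d + ι (r₁ (w , k))) e) (+-comm (ι (r₂ (w , k))) _)
    ...   | false | e = cong (λ d → ι d + 0) e

  module Swap (col : Col) (col-sym : Symmetric col) {x y : Fin n} (x≢y : x ≢ y)
              (S : Slot → Bool) (S-off : ∀ t → S t ≡ true → off x y t ≡ true) where

    -- The transposition of x and y. Applying it to both ends of an edge makes the new colouring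
    -- symmetric and fixes every edge that avoids x and y.
    σ : Fin n → Fin n
    σ u = if does (u Fin.≟ x) then y else if does (u Fin.≟ y) then x else u

    σ-x : σ x ≡ y
    σ-x = if-true (dec-true (x Fin.≟ x) refl)

    σ-y : σ y ≡ x
    σ-y = trans (if-false (dec-false (y Fin.≟ x) (x≢y ∘ sym))) (if-true (dec-true (y Fin.≟ y) refl))

    σ-other : ∀ {u} → u ≢ x → u ≢ y → σ u ≡ u
    σ-other {u} u≢x u≢y = trans (if-false (dec-false (u Fin.≟ x) u≢x)) (if-false (dec-false (u Fin.≟ y) u≢y))

    -- In each slot (w , k) of S the colours of the k-th edges xw and yw are exchanged.
    col′ : Col
    col′ u v k = if S (u , k) ∨ S (v , k) then col (σ u) (σ v) k else col u v k

    S-x : ∀ k → S (x , k) ≡ false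
    S-x k with S (x , k) in eq
    ... | false = refl
    ... | true  = contradiction refl (proj₁ (off⁻¹ {x} {y} {k = k} (S-off _ eq)))

    S-y : ∀ k → S (y , k) ≡ false
    S-y k with S (y , k) in eq
    ... | false = refl
    ... | true  = contradiction refl (proj₂ (off⁻¹ {x} {y} {k = k} (S-off _ eq)))

    col′-sym : Symmetric col′
    col′-sym u v k = trans (if-cong (Bool.∨-comm (S (u , k)) (S (v , k))))
      (cong₂ (λ a b → if S (v , k) ∨ S (u , k) then a else b) (col-sym (σ u) (σ v) k) (col-sym u v k))

    col′-x : ∀ {w} k → w ≢ x → w ≢ y → col′ x w k ≡ (if S (w , k) then col y w k else col x w k)
    col′-x {w} k w≢x w≢y = trans (if-cong (cong (_∨ S (w , k)) (S-x k)))
      (cong₂ (λ a b → if S (w , k) then col a b k else col x w k) σ-x (σ-other w≢x w≢y))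

    col′-y : ∀ {w} k → w ≢ x → w ≢ y → col′ y w k ≡ (if S (w , k) then col x w k else col y w k)
    col′-y {w} k w≢x w≢y = trans (if-cong (cong (_∨ S (w , k)) (S-y k)))
      (cong₂ (λ a b → if S (w , k) then col a b k else col y w k) σ-y (σ-other w≢x w≢y))

    col′-xy : ∀ k → col′ x y k ≡ col x y k
    col′-xy k = if-false (cong₂ _∨_ (S-x k) (S-y k))

    col′-off : ∀ {u v} k → u ≢ x → u ≢ y → v ≢ x → v ≢ y → col′ u v k ≡ col u v k
    col′-off {u} {v} k u≢x u≢y v≢x v≢y with S (u , k) ∨ S (v , k)
    ... | true  = cong₂ (λ a b → col a b k) (σ-other u≢x u≢y) (σ-other v≢x v≢y)
    ... | false = refl

    degree-x : ∀ c → degree col′ c x + cnt S (row col x) c ≡ degree col c x + cnt S (row col y) c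
    degree-x = row-exchange S (row col′ x) (row col x) (row col y) S-x S-y col′-xy (λ w k → col′-x k)

    degree-y : ∀ c → degree col′ c y + cnt S (row col y) c ≡ degree col c y + cnt S (row col x) c
    degree-y = row-exchange S (row col′ y) (row col y) (row col x) S-y S-x
      (λ k → trans (col′-sym y x k) (trans (col′-xy k) (col-sym x y k))) (λ w k w≢y w≢x → col′-y k w≢x w≢y)

    degree-xy : ∀ c → degree col′ c x + degree col′ c y ≡ degree col c x + degree col c y
    degree-xy c = +-cancelʳ-≡ (A + B) _ _ (begin
      (degree col′ c x + degree col′ c y) + (A + B) ≡⟨ interchange (degree col′ c x) _ A B ⟩
      (degree col′ c x + A) + (degree col′ c y + B) ≡⟨ cong₂ _+_ (degree-x c) (degree-y c) ⟩
      (degree col c x + B) + (degree col c y + A)   ≡⟨ interchange (degree col c x) B _ A ⟩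
      (degree col c x + degree col c y) + (B + A)   ≡⟨ cong (degree col c x + degree col c y +_) (+-comm B A) ⟩
      (degree col c x + degree col c y) + (A + B)   ∎)
      where
      open ≡-Reasoning
      A = cnt S (row col x) c
      B = cnt S (row col y) c

    -- At a third vertex `v` the exchange only permutes the colours of the k-th edges vx and vy, so
    -- the sum of these two contributions is unchanged.
    degree-other : ∀ c {v} → v ≢ x → v ≢ y → degree col′ c v ≡ degree col c v
    degree-other c {v} v≢x v≢y = trans (∑-product (allFin n) (allFin lam) _)
      (trans (Count.∑-two-point-≡ (finite-Fin n) x≢y
               (λ w w≢x w≢y → ∑-cong (allFin lam) λ k →
                 cong (λ d → ⟦ not (does (w Fin.≟ v)) ∧ does (d Fin.≟ c) ⟧) (col′-off k v≢x v≢y w≢x w≢y))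
               (trans (sym (∑-+ (allFin lam) _ _)) (trans (∑-cong (allFin lam) pt) (∑-+ (allFin lam) _ _))))
        (sym (∑-product (allFin n) (allFin lam) _)))
      where
      ι : Fin q → ℕ
      ι d = ⟦ does (d Fin.≟ c) ⟧
      pt : ∀ k → ⟦ not (does (x Fin.≟ v)) ∧ does (col′ v x k Fin.≟ c) ⟧ + ⟦ not (does (y Fin.≟ v)) ∧ does (col′ v y k Fin.≟ c) ⟧ ≡
                 ⟦ not (does (x Fin.≟ v)) ∧ does (col v x k Fin.≟ c) ⟧ + ⟦ not (does (y Fin.≟ v)) ∧ does (col v y k Fin.≟ c) ⟧
      pt k rewrite dec-false (x Fin.≟ v) (v≢x ∘ sym) | dec-false (y Fin.≟ v) (v≢y ∘ sym)
         with S (v , k) | trans (col′-sym v x k) (col′-x k v≢x v≢y) | trans (col′-sym v y k) (col′-y k v≢x v≢y)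
      ... | true  | ex | ey = trans (cong₂ (λ a b → ι a + ι b) (trans ex (col-sym y v k)) (trans ey (col-sym x v k)))
                                (+-comm (ι (col v y k)) _)
      ... | false | ex | ey = cong₂ (λ a b → ι a + ι b) (trans ex (col-sym x v k)) (trans ey (col-sym y v k))

-- Making all degrees equal to s.

module Balancing (n lam q : ℕ) (old : Fin n → Bool) (P : Colouring n lam q) (s : ℕ) where
  open Degrees n lam q

  -- old marks the vertices of the given λK_m, on which P prescribes the colours.
  record Partial (col : Col) : Set where
    field
      col-sym    : Symmetric col
      agree      : ∀ u v k → old u ≡ true → old v ≡ true → u ≢ v → col u v k ≡ P u v k
      old-degree : ∀ c v → old v ≡ true → degree col c v ≡ s
      total      : ∀ c → ∑ (allFin n) (degree col c) ≡ ∑ (allFin n) λ _ → s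
  open Partial

  old≢new : ∀ {u v} → old u ≡ true → old v ≡ false → u ≢ v
  old≢new ou nv refl = true≢false ou nv

  swap-partial : ∀ {col} (X : Partial col) {x y} (x≢y : x ≢ y) → old x ≡ false → old y ≡ false →
    ∀ S S-off → Partial (Swap.col′ col (col-sym X) x≢y S S-off)
  swap-partial {col} X {x} {y} x≢y nx ny S S-off = record
    { col-sym    = col′-sym
    ; agree      = λ u v k ou ov u≢v →
        trans (col′-off k (old≢new ou nx) (old≢new ou ny) (old≢new ov nx) (old≢new ov ny)) (agree X u v k ou ov u≢v)
    ; old-degree = λ c v ov → trans (degree-other c (old≢new ov nx) (old≢new ov ny)) (old-degree X c v ov)
    ; total      = λ c → trans (Count.∑-two-point-≡ (finite-Fin n) x≢y (λ v → degree-other c) (degree-xy c)) (total X c)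
    }
    where open Swap col (col-sym X) x≢y S S-off

  ∸-drop : ∀ {a a′ b b′} → s < a → suc a′ ≡ a → b < s → b′ ≡ suc b → (a′ ∸ s) + (b′ ∸ s) < (a ∸ s) + (b ∸ s)
  ∸-drop {a′ = a′} {b} (s≤s s≤a′) refl b<s refl =
    subst₂ (λ u v → (a′ ∸ s) + u < v + (b ∸ s)) (sym (m≤n⇒m∸n≡0 b<s)) (sym (+-∸-assoc 1 s≤a′))
      (s≤s (≤-trans (≤-reflexive (+-identityʳ _)) (m≤m+n _ _)))

  -- The excess over `s` is a convex function: moving a unit from the larger number to the smaller
  -- cannot increase the sum.
  ∸-approach : ∀ {a a′ b b′} → a < b → a′ ≡ suc a → suc b′ ≡ b → (a′ ∸ s) + (b′ ∸ s) ≤ (a ∸ s) + (b ∸ s)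
  ∸-approach {a} {b′ = b′} (s≤s a≤b′) refl refl with suc a ≤? s
  ... | yes a<s = subst (λ u → u + (b′ ∸ s) ≤ (a ∸ s) + (suc b′ ∸ s)) (sym (m≤n⇒m∸n≡0 a<s))
                    (≤-trans (∸-monoˡ-≤ s (n≤1+n b′)) (m≤n+m _ (a ∸ s)))
  ... | no  a≮s = ≤-reflexive (trans (cong (_+ (b′ ∸ s)) (+-∸-assoc 1 s≤a))
                    (trans (sym (+-suc (a ∸ s) (b′ ∸ s))) (cong ((a ∸ s) +_) (sym (+-∸-assoc 1 (≤-trans s≤a a≤b′))))))
    where
    s≤a : s ≤ a
    s≤a = s≤s⁻¹ (≰⇒> a≮s)

  excess : Col → Fin n → ℕ
  excess col v = ∑ (allFin q) λ c → degree col c v ∸ s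

  Smaller : Col → Set
  Smaller col = Σ Col λ col′ → Partial col′ × ∑ (allFin n) (excess col′) < ∑ (allFin n) (excess col)

  -- Both vertices are new, because old ones have degree `s`. A trail from `c` passes one edge of
  -- colour `c` from x to y and one of its end colour from y to x; other degrees stay. The end
  -- colour is a sink, hence rarer at x than at y, so its excess does not grow, while that of `c`
  -- drops.
  reduce : ∀ {col} → Partial col → ∀ {c x y} → s < degree col c x → degree col c y < s → Smaller col
  reduce {col} X {c} {x} {y} s<dx dy<s = col′ , swap-partial X x≢y (new x (>⇒≢ s<dx)) (new y (<⇒≢ dy<s)) R.S R.S⊆p ,
      Count.∑-two-point-< (finite-Fin n) x≢y
        (λ v v≢x v≢y → ∑-cong (allFin q) λ g → cong (_∸ s) (degree-other g v≢x v≢y))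
        (subst₂ _<_ (∑-+ (allFin q) _ _) (∑-+ (allFin q) _ _)
          (Count.∑-mono-< (finite-Fin q) weak c strict))
    where
    x≢y : x ≢ y
    x≢y refl = <-asym s<dx dy<s
    new : ∀ v → degree col c v ≢ s → old v ≡ false
    new v d≢s with old v in eq
    ... | false = refl
    ... | true  = contradiction (old-degree X c v eq) d≢s
    p = off x y
    dx : ∀ g → degree col g x ≡ cnt p (row col x) g + mult col g x y
    dx g = degree-off col g x≢y
    dy : ∀ g → degree col g y ≡ cnt p (row col y) g + mult col g x y
    dy g = degree-off′ col g (col-sym X) x≢y
    c-source : cnt p (row col y) c < cnt p (row col x) c
    c-source = +-cancelʳ-< (mult col c x y) _ _ (subst₂ _<_ (dy c) (dx c) (<-trans dy<s s<dx))
    R : Trail.DirectedTrail slots Fin._≟_ p (row col x) (row col y) c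
    R = Trail.trail slots Fin._≟_ {a = row col x} {row col y} c-source
    module R = Trail.DirectedTrail R
    open Swap col (col-sym X) x≢y R.S R.S⊆p
    end≢c : R.end ≢ c
    end≢c e = <-asym c-source (subst (λ z → cnt p (row col x) z < cnt p (row col y) z) e R.end-sink)
    A B : Fin q → ℕ
    A = cnt R.S (row col x)
    B = cnt R.S (row col y)
    A-c : A c ≡ suc (B c)
    A-c = trans (sym (+-identityʳ _)) (trans (subst₂ (λ u v → A c + u ≡ B c + v)
      (cong ⟦_⟧ (dec-false (R.end Fin.≟ c) end≢c)) (cong ⟦_⟧ (dec-true (c Fin.≟ c) refl)) (R.balance c)) (+-comm (B c) 1))
    shift : ∀ {d d′ e f} → e ≡ suc f → d′ + e ≡ d + f → suc d′ ≡ d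
    shift {d} {d′} {f = f} refl eq = +-cancelʳ-≡ f _ _ (trans (sym (+-suc d′ f)) eq)
    shift′ : ∀ {d d′ e f} → e ≡ suc f → d′ + f ≡ d + e → d′ ≡ suc d
    shift′ e≡ eq = sym (shift e≡ (sym eq))
    strict : (degree col′ c x ∸ s) + (degree col′ c y ∸ s) < (degree col c x ∸ s) + (degree col c y ∸ s)
    strict = ∸-drop s<dx (shift A-c (degree-x c)) dy<s (shift′ A-c (degree-y c))
    weak : ∀ g → (degree col′ g x ∸ s) + (degree col′ g y ∸ s) ≤ (degree col g x ∸ s) + (degree col g y ∸ s)
    weak g with c Fin.≟ g
    ... | yes refl = <⇒≤ strict
    ... | no c≢g with R.end Fin.≟ g
    ...   | yes refl = ∸-approach
              (subst₂ _<_ (sym (dx g)) (sym (dy g)) (+-monoˡ-< (mult col g x y) R.end-sink))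
              (shift′ B-g (degree-x g)) (shift B-g (degree-y g))
      where
      B-g : B g ≡ suc (A g)
      B-g = sym (trans (+-comm 1 (A g)) (trans (subst₂ (λ u v → A g + u ≡ B g + v)
        (cong ⟦_⟧ (dec-true (g Fin.≟ g) refl)) (cong ⟦_⟧ (dec-false (c Fin.≟ g) c≢g)) (R.balance g)) (+-identityʳ _)))
    ...   | no end≢g = ≤-reflexive (cong₂ (λ u v → (u ∸ s) + (v ∸ s))
              (+-cancelʳ-≡ (A g) _ _ (trans (degree-x g) (cong (degree col g x +_) (sym A≡B))))
              (+-cancelʳ-≡ (B g) _ _ (trans (degree-y g) (cong (degree col g y +_) A≡B))))
      where
      A≡B : A g ≡ B g
      A≡B = +-cancelʳ-≡ 0 _ _ (subst₂ (λ u v → A g + u ≡ B g + v)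
        (cong ⟦_⟧ (dec-false (R.end Fin.≟ g) end≢g)) (cong ⟦_⟧ (dec-false (c Fin.≟ g) c≢g)) (R.balance g))

  Regular : Col → Set
  Regular col = ∀ c v → degree col c v ≡ s

  overfull? : ∀ col → Dec (∃ λ c → ∃ λ x → s < degree col c x)
  overfull? col = Fin.any? λ c → Fin.any? λ x → s <? degree col c x

  underfull? : ∀ col c → Dec (∃ λ y → degree col c y < s)
  underfull? col c = Fin.any? λ y → degree col c y <? s

  -- The prescribed total forces a vertex below `s` in every colour in which some vertex lies above.
  improve : ∀ {col} → Partial col → Regular col ⊎ Smaller col
  improve {col} X = at (overfull? col)
    where
    to : ∀ {c x} → s < degree col c x → Dec (∃ λ y → degree col c y < s) → Smaller col
    to s<dx (yes (y , dy<s)) = reduce X s<dx dy<s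
    to {c} {x} s<dx (no none) = contradiction
      (Count.∑-≡⇒≗ (finite-Fin n) (λ v → ≮⇒≥ λ lt → none (v , lt)) (sym (total X c)) x) (<⇒≢ s<dx)
    at : Dec (∃ λ c → ∃ λ x → s < degree col c x) → Regular col ⊎ Smaller col
    at (no none) = inj₁ λ c → Count.∑-≡⇒≗ (finite-Fin n) (λ v → ≮⇒≥ λ lt → none (c , v , lt)) (total X c)
    at (yes (c , x , s<dx)) = inj₂ (to s<dx (underfull? col c))

  balance : ∀ {col} → Partial col → Σ Col λ col′ → Partial col′ × Regular col′
  balance X = go _ X ≤-refl
    where
    go : ∀ N {col} → Partial col → ∑ (allFin n) (excess col) ≤ N → Σ Col λ col′ → Partial col′ × Regular col′
    next : ∀ N {col} → Partial col → ∑ (allFin n) (excess col) ≤ N → Regular col ⊎ Smaller col →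
      Σ Col λ col′ → Partial col′ × Regular col′
    go N X ≤N = next N X ≤N (improve X)
    next N       X ≤N (inj₁ reg)            = _ , X , reg
    next zero    X ≤N (inj₂ (_ , _ , lt))   = contradiction (≤-trans lt ≤N) λ ()
    next (suc N) X ≤N (inj₂ (_ , X′ , lt))  = go N X′ (s≤s⁻¹ (≤-trans lt ≤N))

-- Connecting the colour classes.

star-refine : ∀ {T : Set} {R R′ : T → T → Set} {z v} → (∀ {u v} → Star R z u → R u v → R′ u v) →
  Star R z v → Star R′ z v
star-refine {R = R} {R′} {z} up = go ε
  where
  go : ∀ {u v} → Star R z u → Star R u v → Star R′ u v
  go p ε        = ε
  go p (r ◅ rs) = up p r ◅ go (p ◅◅ (r ◅ ε)) rs

star-bind : ∀ {T : Set} {R R′ : T → T → Set} → (∀ {u v} → R u v → Star R′ u v) → ∀ {u v} → Star R u v → Star R′ u v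
star-bind f ε        = ε
star-bind f (r ◅ rs) = f r ◅◅ star-bind f rs

module Connecting (n lam q : ℕ) (old : Fin n → Bool) (P : Colouring n lam q) (s : ℕ) (2≤s : 2 ≤ s)
  (old-degree< : ∀ c u → old u ≡ true →
    Degrees.♯ n lam q (λ t → not (does (proj₁ t Fin.≟ u)) ∧ (old (proj₁ t) ∧ does (P u (proj₁ t) (proj₂ t) Fin.≟ c))) < s)
  (root : Fin n) (root-new : old root ≡ false) where
  open Degrees n lam q
  open Balancing n lam q old P s
  open Partial

  old-or-new : ∀ u → old u ≡ true ⊎ old u ≡ false
  old-or-new u with old u
  ... | true  = inj₁ refl
  ... | false = inj₂ refl

  adj? : ∀ (col : Col) c u v → Dec (Adj col c u v)
  adj? col c u v = ¬? (u Fin.≟ v) ×-dec Fin.any? λ k → col u v k Fin.≟ c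

  reach? : ∀ (col : Col) c u v → Dec (Star (Adj col c) u v)
  reach? col c = Reachability.star? (finite-Fin n) (adj? col c)

  Avoiding : Col → Fin q → Fin n → Fin n → Fin n → Set
  Avoiding col c x u v = Adj col c u v × u ≢ x × v ≢ x

  avoid? : ∀ (col : Col) c x u v → Dec (Star (Avoiding col c x) u v)
  avoid? col c x = Reachability.star? (finite-Fin n) λ u v →
    adj? col c u v ×-dec (¬? (u Fin.≟ x) ×-dec ¬? (v Fin.≟ x))

  avoid-end : ∀ {col c x u v} → u ≢ x → Star (Avoiding col c x) u v → v ≢ x
  avoid-end u≢x ε                      = u≢x
  avoid-end u≢x ((_ , _ , w≢x) ◅ rest) = avoid-end w≢x rest

  module Closed {col : Col} (X : Partial col) (reg : Regular col) (c : Fin q) where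

    adj-sym : ∀ {u v} → Adj col c u v → Adj col c v u
    adj-sym (u≢v , k , e) = u≢v ∘ sym , k , trans (col-sym X _ _ k) e

    avoid-sym : ∀ {x u v} → Avoiding col c x u v → Avoiding col c x v u
    avoid-sym (a , u≢x , v≢x) = adj-sym a , v≢x , u≢x

    another-edge : ∀ v t₀ → ∃ λ w → ∃ λ k → (w , k) ≢ t₀ × w ≢ v × col v w k ≡ c
    another-edge v t₀ with Count.second slots (subst (2 ≤_) (sym (reg c v)) 2≤s) t₀
    ... | (w , k) , ≢t₀ , h with ∧-true h
    ...   | w≟v , e = w , k , ≢t₀ , does⁻¹-false (w Fin.≟ v) (not⁻¹ w≟v) , does⁻¹ (col v w k Fin.≟ c) e

    -- The other old vertices account for fewer than `s` of the edges of colour `c` at `u`; this is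
    -- what `r < s` provides.
    new-neighbour : ∀ u → old u ≡ true → ∃ λ w → ∃ λ k → old w ≡ false × w ≢ u × col u w k ≡ c
    new-neighbour u ou with Count.♯-<⇒∃ slots (subst (_ <_) (sym (reg c u)) (old-degree< c u ou))
    ... | (w , k) , notold , h with ∧-true h
    ...   | w≟u , e = w , k , ow , w≢u , e′
      where
      w≢u = does⁻¹-false (w Fin.≟ u) (not⁻¹ w≟u)
      e′  = does⁻¹ (col u w k Fin.≟ c) e
      ow : old w ≡ false
      ow with old-or-new w
      ... | inj₂ nw = nw
      ... | inj₁ ow = contradiction notold (true≢false (cong₂ _∧_ w≟u (cong₂ _∧_ ow
              (dec-true (P u w k Fin.≟ c) (trans (sym (agree X u w k ou ow (w≢u ∘ sym))) e′)))))

    -- The edges at `x` differ as slots, so `z₁` and `z₂` may coincide when the edges are parallel.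
    -- The stick keeps the figure in the component of `root`, hence away from any unreached vertex.
    record Lollipop : Set where
      field
        x        : Fin n
        x-new    : old x ≡ false
        stick    : Star (Adj col c) root x
        {z₁ z₂}  : Fin n
        {k₁ k₂}  : Fin lam
        z₁≢x     : z₁ ≢ x
        z₂≢x     : z₂ ≢ x
        e₁       : col x z₁ k₁ ≡ c
        e₂       : col x z₂ k₂ ≡ c
        distinct : (z₂ , k₂) ≢ (z₁ , k₁)
        loop     : Star (Avoiding col c x) z₁ z₂

    -- The measure of the search: the size of the part of the colour class that lies behind `x` as
    -- seen through `z`.
    component : Fin n → Fin n → ℕ
    component x z = Count.♯ (finite-Fin n) λ v → does (avoid? col c x z v)

    record Exit (x z : Fin n) : Set where
      field
        x′     : Fin n
        x′-new : old x′ ≡ false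
        x′≢x   : x′ ≢ x
        path   : Star (Avoiding col c x) z x′

    -- The new neighbour of an old `z` might be `x` itself, by the very edge just used. Hence the
    -- search takes a second edge at `z`; if that leads to another old vertex, a new neighbour of
    -- the latter is either outside `x` or closes a cycle through `x`.
    exit : ∀ {x} → old x ≡ false → Star (Adj col c) root x → ∀ {z k} → z ≢ x → col x z k ≡ c → Lollipop ⊎ Exit x z
    exit {x} nx stick {z} {k} z≢x xz = at (old-or-new z)
      where
      pop : ∀ {u k′} → u ≢ x → col x u k′ ≡ c → (u , k′) ≢ (z , k) → Star (Avoiding col c x) z u → Lollipop
      pop u≢x xu ≢t p = record { x-new = nx ; stick = stick ; z₁≢x = z≢x ; z₂≢x = u≢x ; e₁ = xz ; e₂ = xu ; distinct = ≢t ; loop = p }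
      leave : ∀ {u} → old u ≡ false → u ≢ x → Star (Avoiding col c x) z u → Lollipop ⊎ Exit x z
      leave nu u≢x p = inj₂ (record { x′-new = nu ; x′≢x = u≢x ; path = p })
      far : ∀ {u} → u ≢ x → u ≢ z → Star (Avoiding col c x) z u → old u ≡ true → Lollipop ⊎ Exit x z
      far {u} u≢x u≢z p ou with new-neighbour u ou
      ... | w , k″ , nw , w≢u , uw with w Fin.≟ x
      ...   | yes refl = inj₁ (pop u≢x (trans (col-sym X x u k″) uw) (u≢z ∘ cong proj₁) p)
      ...   | no  w≢x  = leave nw w≢x (p ◅◅ (((w≢u ∘ sym , k″ , uw) , u≢x , w≢x) ◅ ε))
      at : old z ≡ true ⊎ old z ≡ false → Lollipop ⊎ Exit x z
      at (inj₂ nz) = leave nz z≢x ε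
      at (inj₁ oz) with another-edge z (x , k)
      ... | u , k′ , ≢t , u≢z , zu with u Fin.≟ x
      -- Two parallel edges between `x` and `z` form the cycle; the path avoiding `x` is empty.
      ...   | yes refl = inj₁ (pop z≢x (trans (col-sym X x z k′) zu) (λ { refl → ≢t refl }) ε)
      ...   | no  u≢x with old-or-new u
      ...     | inj₂ nu = leave nu u≢x (((u≢z ∘ sym , k′ , zu) , z≢x , u≢x) ◅ ε)
      ...     | inj₁ ou = far u≢x u≢z (((u≢z ∘ sym , k′ , zu) , z≢x , u≢x) ◅ ε) ou

    -- By separation nothing behind `x′` leads to `x`, so that part is contained in the part behind
    -- `x`; the latter also contains `x′`.
    component-< : ∀ {x x′ z z′ k′} → x′ ≢ x → Star (Avoiding col c x) z x′ → z′ ≢ x′ → col x′ z′ k′ ≡ c →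
      ¬ Star (Avoiding col c x′) z′ x → component x′ z′ < component x z
    component-< {x} {x′} {z} {z′} {k′} x′≢x p z′≢x′ e sep =
      Count.∑-mono-< (finite-Fin n)
        (λ v → ⟦⟧-mono λ h → dec-true (avoid? col c x z v) (inside (does⁻¹ (avoid? col c x′ z′ v) h)))
        x′ (subst₂ (λ a b → ⟦ a ⟧ < ⟦ b ⟧)
             (sym (dec-false (avoid? col c x′ z′ x′) λ r → avoid-end z′≢x′ r refl))
             (sym (dec-true (avoid? col c x z x′) p)) z<s)
      where
      z′≢x : z′ ≢ x
      z′≢x refl = sep ε
      inside : ∀ {v} → Star (Avoiding col c x′) z′ v → Star (Avoiding col c x) z v
      inside r = p ◅◅ (((z′≢x′ ∘ sym , k′ , e) , x′≢x , z′≢x) ◅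
        star-refine (λ {u} {w} q a → proj₁ a , (λ { refl → sep q }) , (λ { refl → sep (q ◅◅ (a ◅ ε)) })) r)

    -- If no two edges at x lie on a common cycle, then z exits to a new vertex x′, of whose two edges
    -- one leads away from x; the component cut off there is smaller.
    lollipop-from : ∀ N {x} → old x ≡ false → Star (Adj col c) root x → ∀ {z k} → z ≢ x → col x z k ≡ c →
      component x z ≤ N → Lollipop
    lollipop-from N {x} nx stick {z} {k} z≢x xz ≤N = at (exit nx stick z≢x xz)
      where
      recurse : ∀ M → component x z ≤ M → (E : Exit x z) → ∀ {z′ k′} → z′ ≢ Exit.x′ E → col (Exit.x′ E) z′ k′ ≡ c →
        Star (Adj col c) root (Exit.x′ E) → ¬ Star (Avoiding col c (Exit.x′ E)) z′ x → Lollipop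
      recurse zero    ≤M E z′≢ e stick′ sep = contradiction
        (≤-trans (component-< (Exit.x′≢x E) (Exit.path E) z′≢ e sep) ≤M) λ ()
      recurse (suc M) ≤M E z′≢ e stick′ sep = lollipop-from M (Exit.x′-new E) stick′ z′≢ e
        (s≤s⁻¹ (≤-trans (component-< (Exit.x′≢x E) (Exit.path E) z′≢ e sep) ≤M))
      at : Lollipop ⊎ Exit x z → Lollipop
      at (inj₁ L) = L
      at (inj₂ E) with another-edge (Exit.x′ E) (z , k)
      ... | z₁ , k₁ , _ , z₁≢ , e₁ with another-edge (Exit.x′ E) (z₁ , k₁)
      ...   | z₂ , k₂ , dist , z₂≢ , e₂ with avoid? col c (Exit.x′ E) z₁ x | avoid? col c (Exit.x′ E) z₂ x
      ...     | yes p₁ | yes p₂ = record { x-new = Exit.x′-new E ; stick = stick′ ; z₁≢x = z₁≢ ; z₂≢x = z₂≢ ; e₁ = e₁ ; e₂ = e₂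
                                         ; distinct = dist ; loop = p₁ ◅◅ star-reverse avoid-sym p₂ }
        where
        stick′ = stick ◅◅ ((z≢x ∘ sym , k , xz) ◅ star-bind (λ a → proj₁ a ◅ ε) (Exit.path E))
      ...     | no sep | _ = recurse N ≤N E z₁≢ e₁ (stick ◅◅ ((z≢x ∘ sym , k , xz) ◅ star-bind (λ a → proj₁ a ◅ ε) (Exit.path E))) sep
      ...     | yes _ | no sep = recurse N ≤N E z₂≢ e₂ (stick ◅◅ ((z≢x ∘ sym , k , xz) ◅ star-bind (λ a → proj₁ a ◅ ε) (Exit.path E))) sep

    lollipop : Fin lam → Lollipop
    -- The excluded slot is a loop and thus no edge: any edge at `root` may start the search.
    lollipop k₀ with another-edge root (root , k₀)
    ... | z , k , _ , z≢ , e = lollipop-from _ root-new ε z≢ e ≤-refl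

  Off : Col → Fin q → Fin n → Fin n → Fin n → Fin n → Set
  Off col d x y u v = Adj col d u v × (u ≢ x × u ≢ y) × (v ≢ x × v ≢ y)

  -- The path x z ... w y, with its end edges recorded as slots because an exchange can affect only
  -- them: `inner` avoids x and y.
  record Through (col : Col) (d : Fin q) (x y : Fin n) : Set where
    field
      {z w}  : Fin n
      {k k′} : Fin lam
      z-off  : z ≢ x × z ≢ y
      w-off  : w ≢ x × w ≢ y
      xz     : col x z k ≡ d
      yw     : col y w k′ ≡ d
      inner  : Star (Off col d x y) z w

  Link : Col → Fin q → Fin n → Fin n → Set
  Link col d x y = (∃ λ k → col x y k ≡ d) ⊎ Through col d x y

  -- The walk is cut at its first arrival at y and restarted at every return to x before that.
  link : ∀ {col} → Symmetric col → ∀ {d x y} → x ≢ y → Star (Adj col d) x y → Link col d x y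
  link {col} col-sym {d} {x} {y} x≢y = from-x
    where
    Suffix : Fin n → Set
    Suffix u = ∃ λ w → ∃ λ k′ → (w ≢ x × w ≢ y) × col y w k′ ≡ d × Star (Off col d x y) u w
    from-x   : Star (Adj col d) x y → Link col d x y
    from-off : ∀ {u} → u ≢ x → u ≢ y → Star (Adj col d) u y → Link col d x y ⊎ Suffix u
    from-x ε = contradiction refl x≢y
    from-x (_◅_ {j = w} (x≢w , k , xw) rest) with w Fin.≟ y
    ... | yes refl = inj₁ (k , xw)
    ... | no w≢y with from-off (x≢w ∘ sym) w≢y rest
    ...   | inj₁ l = l
    ...   | inj₂ (w′ , k′ , w′-off , yw′ , inner) =
      inj₂ (record { z-off = x≢w ∘ sym , w≢y ; w-off = w′-off ; xz = xw ; yw = yw′ ; inner = inner })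
    from-off u≢x u≢y ε = contradiction refl u≢y
    from-off {u} u≢x u≢y (_◅_ {j = w} (u≢w , k , uw) rest) with w Fin.≟ y | w Fin.≟ x
    ... | yes refl | _        = inj₂ (u , k , (u≢x , u≢y) , trans (col-sym y u k) uw , ε)
    ... | no _     | yes refl = inj₁ (from-x rest)
    ... | no w≢y   | no w≢x   with from-off w≢x w≢y rest
    ...   | inj₁ l = inj₁ l
    ...   | inj₂ (w′ , k′ , w′-off , yw′ , inner) =
      inj₂ (w′ , k′ , w′-off , yw′ , ((u≢w , k , uw) , (u≢x , u≢y) , (w≢x , w≢y)) ◅ inner)

  through-slots : ∀ {col d x y} → Link col d x y → Maybe (Slot × Slot)
  through-slots (inj₁ _) = nothing
  through-slots (inj₂ T) = just ((z , k) , (w , k′))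
    where open Through T

  link-slots : ∀ {col d x y} → Dec (Link col d x y) → Maybe (Slot × Slot)
  link-slots (yes l) = through-slots l
  link-slots (no _)  = nothing

  link-slots-valid : ∀ {col d x y} (l? : Dec (Link col d x y)) t u → link-slots l? ≡ just (t , u) →
    (off x y t ≡ true × row col x t ≡ d) × (off x y u ≡ true × row col y u ≡ d)
  link-slots-valid (yes (inj₂ T)) t u refl =
    (off-intro {k = k} (proj₁ z-off) (proj₂ z-off) , xz) , (off-intro {k = k′} (proj₁ w-off) (proj₂ w-off) , yw)
    where open Through T

  Connected-in : Col → Fin q → Set
  Connected-in col c = ∀ u v → Star (Adj col c) u v

  module Merge {col : Col} (X : Partial col) (reg : Regular col) (c : Fin q)
    (L : Closed.Lollipop X reg c) {y : Fin n} (y-new : old y ≡ false) (y-far : ¬ Star (Adj col c) root y) where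
    open Closed.Lollipop L
    open Closed X reg c using (adj-sym)

    x≢y : x ≢ y
    x≢y refl = y-far stick

    link? : ∀ d → Dec (Link col d x y)
    link? d = map′ (link (col-sym X) x≢y) unlink (reach? col d x y)
      where
      unlink : Link col d x y → Star (Adj col d) x y
      unlink (inj₁ (k , e)) = (x≢y , k , e) ◅ ε
      unlink (inj₂ T) = ((proj₁ z-off ∘ sym) , _ , xz) ◅ (star-bind (λ a → proj₁ a ◅ ε) inner
                          ◅◅ ((proj₂ w-off , _ , trans (col-sym X _ y _) yw) ◅ ε))
        where open Through T

    root-z₁ : Star (Adj col c) root z₁
    root-z₁ = stick ◅◅ ((z₁≢x ∘ sym , k₁ , e₁) ◅ ε)

    root-z₂ : Star (Adj col c) root z₂
    root-z₂ = stick ◅◅ ((z₂≢x ∘ sym , k₂ , e₂) ◅ ε)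

    near≢y : ∀ {u} → Star (Adj col c) root u → u ≢ y
    near≢y r refl = y-far r

    -- All degrees at `x` and `y` are `s`; after cancelling the edges between them, arrivals equal
    -- departures in every colour, which is the balance that `exchange` requires.
    E : Marking.Exchange slots Fin._≟_ (off x y) (row col x) (row col y) c (z₁ , k₁) (λ d → link-slots (link? d))
    E = Marking.exchange slots Fin._≟_ (off-intro {k = k₁} z₁≢x (near≢y root-z₁)) e₁
      (λ d → +-cancelʳ-≡ (mult col d x y) _ _
        (trans (sym (degree-off col d x≢y)) (trans (trans (reg d x) (sym (reg d y))) (degree-off′ col d (col-sym X) x≢y))))
      (λ d → link-slots-valid (link? d))
    module E = Marking.Exchange E
    open Swap col (col-sym X) x≢y E.S E.S⊆p

    merged : Partial col′
    merged = swap-partial X x≢y (x-new) y-new E.S E.S⊆p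

    merged-regular : Regular col′
    merged-regular d v = at (v Fin.≟ x) (v Fin.≟ y)
      where
      at-x : degree col′ d x ≡ s
      at-x = trans (+-cancelʳ-≡ _ _ _ (trans (degree-x d) (cong (degree col d x +_) (sym (E.balanced d))))) (reg d x)
      at-y : degree col′ d y ≡ s
      at-y = trans (+-cancelʳ-≡ _ _ _ (trans (degree-y d) (cong (degree col d y +_) (E.balanced d)))) (reg d y)
      at : Dec (v ≡ x) → Dec (v ≡ y) → degree col′ d v ≡ s
      at (yes v≡x) _         = subst (λ u → degree col′ d u ≡ s) (sym v≡x) at-x
      at (no _)    (yes v≡y) = subst (λ u → degree col′ d u ≡ s) (sym v≡y) at-y
      at (no v≢x)  (no v≢y)  = trans (degree-other d v≢x v≢y) (reg d v)

    S? : ∀ t → E.S t ≡ true ⊎ E.S t ≡ false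
    S? t with E.S t
    ... | true  = inj₁ refl
    ... | false = inj₂ refl

    adj′-sym : ∀ {d u v} → Adj col′ d u v → Adj col′ d v u
    adj′-sym (u≢v , k , e) = u≢v ∘ sym , k , trans (col′-sym _ _ k) e

    x-kept : ∀ {d w k} → w ≢ x × w ≢ y → E.S (w , k) ≡ false → col x w k ≡ d → Adj col′ d x w
    x-kept {k = k} (w≢x , w≢y) Sw e = w≢x ∘ sym , k , trans (col′-x k w≢x w≢y) (trans (if-false Sw) e)

    y-kept : ∀ {d w k} → w ≢ x × w ≢ y → E.S (w , k) ≡ false → col y w k ≡ d → Adj col′ d y w
    y-kept {k = k} (w≢x , w≢y) Sw e = w≢y ∘ sym , k , trans (col′-y k w≢x w≢y) (trans (if-false Sw) e)

    x-moved : ∀ {d w k} → w ≢ x × w ≢ y → E.S (w , k) ≡ true → col x w k ≡ d → Adj col′ d y w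
    x-moved {k = k} (w≢x , w≢y) Sw e = w≢y ∘ sym , k , trans (col′-y k w≢x w≢y) (trans (if-true Sw) e)

    y-moved : ∀ {d w k} → w ≢ x × w ≢ y → E.S (w , k) ≡ true → col y w k ≡ d → Adj col′ d x w
    y-moved {k = k} (w≢x , w≢y) Sw e = w≢x ∘ sym , k , trans (col′-x k w≢x w≢y) (trans (if-true Sw) e)

    off-kept : ∀ {d u v} → Off col d x y u v → Adj col′ d u v
    off-kept ((u≢v , k , e) , (u≢x , u≢y) , (v≢x , v≢y)) = u≢v , k , trans (col′-off k u≢x u≢y v≢x v≢y) e

    -- If both end slots are exchanged, the inner path is traversed backwards: x w ... z y.
    keep-link : ∀ {d} → d ≢ c → (l? : Dec (Link col d x y)) →
      (∀ t u → link-slots l? ≡ just (t , u) → E.S t ≡ E.S u) → Star (Adj col d) x y → Star (Adj col′ d) x y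
    keep-link d≢c (no ¬l) _ p = contradiction (link (col-sym X) x≢y p) ¬l
    keep-link d≢c (yes (inj₁ (k , e))) _ p = (x≢y , k , trans (col′-xy k) e) ◅ ε
    keep-link d≢c (yes (inj₂ T)) same p = at (S? (z , k))
      where
      open Through T
      Sz≡Sw : E.S (z , k) ≡ E.S (w , k′)
      Sz≡Sw = same (z , k) (w , k′) refl
      inner′ = star-bind (λ a → off-kept a ◅ ε) inner
      at : E.S (z , k) ≡ true ⊎ E.S (z , k) ≡ false → Star (Adj col′ _) x y
      at (inj₂ Sz) = x-kept z-off Sz xz ◅ (inner′ ◅◅ (adj′-sym (y-kept w-off (trans (sym Sz≡Sw) Sz) yw) ◅ ε))
      at (inj₁ Sz) = y-moved w-off (trans (sym Sz≡Sw) Sz) yw ◅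
        (star-reverse adj′-sym inner′ ◅◅ (adj′-sym (x-moved z-off Sz xz) ◅ ε))

    -- The edge at `z₁` now ends in `y`, the one at `z₂` stays at `x`, and the loop between them
    -- survives because it avoids `x` and lies in the component of `root`, which does not contain
    -- `y`.
    new-link : Star (Adj col′ c) x y
    new-link = x-kept (z₂≢x , near≢y root-z₂) S-z₂ e₂ ◅
      (star-reverse adj′-sym loop′ ◅◅ (adj′-sym (x-moved (z₁≢x , near≢y root-z₁) E.S-z e₁) ◅ ε))
      where
      S-z₂ : E.S (z₂ , k₂) ≡ false
      S-z₂ = E.S-only (z₂ , k₂) (off-intro {k = k₂} z₂≢x (near≢y root-z₂)) e₂ distinct
      loop′ : Star (Adj col′ c) z₁ z₂
      loop′ = star-refine (λ r (a , u≢x , v≢x) →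
        let root-u = root-z₁ ◅◅ star-bind (λ b → proj₁ b ◅ ε) r in
        off-kept (a , (u≢x , near≢y root-u) , (v≢x , near≢y (root-u ◅◅ (a ◅ ε))))) loop

    -- An exchanged edge keeps its third vertex and passes from one of `x`, `y` to the other; the
    -- path between these two repairs the difference.
    keep-edge : ∀ {d} → Star (Adj col′ d) x y → ∀ {u v} → Adj col d u v → Star (Adj col′ d) u v
    keep-edge {d} xy {u} {v} (u≢v , k , e) with u Fin.≟ x | u Fin.≟ y | v Fin.≟ x | v Fin.≟ y
    ... | yes refl | yes refl | _        | _        = contradiction refl x≢y
    ... | yes refl | no _     | yes refl | _        = contradiction refl u≢v
    ... | yes refl | no _     | no _     | yes refl = xy
    ... | yes refl | no _     | no v≢x   | no v≢y   = at (S? (v , k))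
      where
      at : E.S (v , k) ≡ true ⊎ E.S (v , k) ≡ false → Star (Adj col′ d) x v
      at (inj₁ Sv) = xy ◅◅ (x-moved (v≢x , v≢y) Sv e ◅ ε)
      at (inj₂ Sv) = x-kept (v≢x , v≢y) Sv e ◅ ε
    ... | no _     | yes refl | yes refl | _        = star-reverse adj′-sym xy
    ... | no _     | yes refl | no _     | yes refl = contradiction refl u≢v
    ... | no _     | yes refl | no v≢x   | no v≢y   = at (S? (v , k))
      where
      at : E.S (v , k) ≡ true ⊎ E.S (v , k) ≡ false → Star (Adj col′ d) y v
      at (inj₁ Sv) = star-reverse adj′-sym xy ◅◅ (y-moved (v≢x , v≢y) Sv e ◅ ε)
      at (inj₂ Sv) = y-kept (v≢x , v≢y) Sv e ◅ ε
    ... | no u≢x   | no u≢y   | yes refl | _        = at (S? (u , k))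
      where
      at : E.S (u , k) ≡ true ⊎ E.S (u , k) ≡ false → Star (Adj col′ d) u x
      at (inj₁ Su) = (adj′-sym (x-moved (u≢x , u≢y) Su (trans (col-sym X x u k) e)) ◅ ε) ◅◅ star-reverse adj′-sym xy
      at (inj₂ Su) = adj′-sym (x-kept (u≢x , u≢y) Su (trans (col-sym X x u k) e)) ◅ ε
    ... | no u≢x   | no u≢y   | no _     | yes refl = at (S? (u , k))
      where
      at : E.S (u , k) ≡ true ⊎ E.S (u , k) ≡ false → Star (Adj col′ d) u y
      at (inj₁ Su) = (adj′-sym (y-moved (u≢x , u≢y) Su (trans (col-sym X y u k) e)) ◅ ε) ◅◅ xy
      at (inj₂ Su) = adj′-sym (y-kept (u≢x , u≢y) Su (trans (col-sym X y u k) e)) ◅ ε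
    ... | no u≢x   | no u≢y   | no v≢x   | no v≢y   = off-kept ((u≢v , k , e) , (u≢x , u≢y) , (v≢x , v≢y)) ◅ ε

    keep-connected : ∀ {d} → d ≢ c → Connected-in col d → Connected-in col′ d
    keep-connected {d} d≢c conn u v = star-bind
      (keep-edge (keep-link d≢c (link? d) (λ t u → E.S-pair d t u d≢c) (conn x y))) (conn u v)

    keep-reach : ∀ {u v} → Star (Adj col c) u v → Star (Adj col′ c) u v
    keep-reach = star-bind (keep-edge new-link)

    root-y : Star (Adj col′ c) root y
    root-y = keep-reach stick ◅◅ new-link

  unreached : Col → Fin q → ℕ
  unreached col c = Count.♯ (finite-Fin n) λ v → not (does (reach? col c root v))

  record Improved (col : Col) (c : Fin q) : Set where
    field
      {result}  : Col
      partial   : Partial result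
      regular   : Regular result
      connected : Connected-in result c
      kept      : ∀ d → Connected-in col d → Connected-in result d

  connect : ∀ {col} → Partial col → Regular col → Fin lam → ∀ c → Improved col c
  connect X reg k₀ c = go _ X reg ≤-refl
    where
    NewUnreached : Col → Set
    NewUnreached col = ∃ λ y → old y ≡ false × ¬ Star (Adj col c) root y
    go : ∀ N {col} → Partial col → Regular col → unreached col c ≤ N → Improved col c
    at : ∀ N {col} → Partial col → Regular col → unreached col c ≤ N → Dec (NewUnreached col) → Improved col c
    go N {col} X reg ≤N = at N X reg ≤N
      (Fin.any? λ y → (old y Bool.≟ false) ×-dec ¬? (reach? col c root y))
    -- Testing new vertices suffices: an old vertex hangs on a new neighbour.
    at N {col} X reg ≤N (no none) = record { partial = X ; regular = reg ; kept = λ _ → id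
      ; connected = λ u v → star-reverse adj-sym (reached u) ◅◅ reached v }
      where
      open Closed X reg c
      reached-new : ∀ {v} → old v ≡ false → Star (Adj col c) root v
      reached-new {v} nv with reach? col c root v
      ... | yes r = r
      ... | no ¬r = contradiction (v , nv , ¬r) none
      reached : ∀ v → Star (Adj col c) root v
      reached v with old-or-new v
      ... | inj₂ nv = reached-new nv
      ... | inj₁ ov with new-neighbour v ov
      ...   | w , k , nw , w≢v , e = reached-new nw ◅◅ (adj-sym (w≢v ∘ sym , k , e) ◅ ε)
    at N {col} X reg ≤N (yes (y , y-new , y-far)) = shrink N ≤N
      where
      module M = Merge X reg c (Closed.lollipop X reg c k₀) y-new y-far
      col′ = Swap.col′ col (col-sym X) M.x≢y M.E.S M.E.S⊆p
      fewer : unreached col′ c < unreached col c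
      fewer = Count.∑-mono-< (finite-Fin n)
        (λ v → ⟦⟧-mono λ h → cong not (dec-false (reach? col c root v)
          λ r → true≢false (dec-true (reach? col′ c root v) (M.keep-reach r)) (not⁻¹ h)))
        y (subst₂ (λ a b → ⟦ not a ⟧ < ⟦ not b ⟧)
             (sym (dec-true (reach? col′ c root y) M.root-y)) (sym (dec-false (reach? col c root y) y-far)) z<s)
      keep : ∀ d → Connected-in col d → Connected-in col′ d
      -- The colour `c` itself cannot be connected here, as `y` is unreached.
      keep d conn = M.keep-connected (λ { refl → y-far (conn root y) }) conn
      shrink : ∀ N → unreached col c ≤ N → Improved col c
      shrink zero    ≤0 = contradiction (≤-trans fewer ≤0) λ ()
      shrink (suc N) ≤N = record { partial = I.partial ; regular = I.regular ; connected = I.connected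
                                 ; kept = λ d → I.kept d ∘ keep d }
        where
        I = go N M.merged M.merged-regular (s≤s⁻¹ (≤-trans fewer ≤N))
        module I = Improved I

  connect-all : ∀ {col} → Partial col → Regular col → Fin lam →
    Σ Col λ col′ → Partial col′ × Regular col′ × (∀ c → Connected-in col′ c)
  connect-all X reg k₀ = finish (go (allFin q) X reg)
    where
    All-of : List (Fin q) → Set
    All-of cs = Σ Col λ col′ → Partial col′ × Regular col′ × (∀ c → c ∈ cs → Connected-in col′ c)
    go : ∀ cs {col} → Partial col → Regular col → All-of cs
    go []       X reg = _ , X , reg , λ _ ()
    go (c ∷ cs) X reg with go cs X reg
    ... | _ , X′ , reg′ , conn = Improved.result I , Improved.partial I , Improved.regular I , λ where
        d (here refl) → Improved.connected I
        d (there d∈)  → Improved.kept I d (conn d d∈)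
      where
      I = connect X′ reg′ k₀ c
    finish : All-of (allFin q) → Σ Col λ col′ → Partial col′ × Regular col′ × (∀ c → Connected-in col′ c)
    finish (col′ , X′ , reg′ , conn) = col′ , X′ , reg′ , λ c → conn c (∈-allFin c)

-- Quotas, degree sums and the first colouring.

∑-one-hot : ∀ {q} (d : Fin q) → ∑ (allFin q) (λ c → ⟦ does (d Fin.≟ c) ⟧) ≡ 1
∑-one-hot {q} d = trans (∑-cong (allFin q) λ c → cong ⟦_⟧ (bool-≡
  (λ h → dec-true (c Fin.≟ d) (sym (does⁻¹ (d Fin.≟ c) h))) (λ h → dec-true (d Fin.≟ c) (sym (does⁻¹ (c Fin.≟ d) h)))))
  (Finite.once (finite-Fin q) d)

module _ {T : Set} (fin : Finite T) {q : ℕ} where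
  open Finite fin
  open Count fin
  open Trail fin {Fin q} Fin._≟_ using (cnt)

  -- One element of `p` at a time receives a colour with a positive quota. `c₀` is the default
  -- outside `p`, where nothing is counted.
  fill : Fin q → ∀ (p : T → Bool) (ℓ : Fin q → ℕ) → ∑ (allFin q) ℓ ≡ ♯ p →
    Σ (T → Fin q) λ f → ∀ c → cnt p f c ≡ ℓ c
  fill c₀ p ℓ eq = go (♯ p) p ℓ refl eq
    where
    go : ∀ N p ℓ → ♯ p ≡ N → ∑ (allFin q) ℓ ≡ ♯ p → Σ (T → Fin q) λ f → ∀ c → cnt p f c ≡ ℓ c
    go zero p ℓ ♯p≡0 eq = (λ _ → c₀) , λ c → trans
      (n≤0⇒n≡0 (≤-trans (∑-mono elems (λ t → ⟦⟧-mono (proj₁ ∘ ∧-true))) (≤-reflexive ♯p≡0)))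
      (sym (n≤0⇒n≡0 (≤-trans (Count.term≤∑ (finite-Fin q) ℓ c) (≤-reflexive (trans eq ♯p≡0)))))
    go (suc N) p ℓ ♯p≡ eq with ♯-pos {p} (subst (0 <_) (sym ♯p≡) z<s)
       | ∑-<⇒∃< (allFin q) {λ _ → 0} {ℓ} (subst₂ _<_ (sym (∑-zero (allFin q) λ _ → refl)) (sym (trans eq ♯p≡)) z<s)
    ... | t , pt | c , 0<ℓc = f , counts
      where
      ι ℓ′ : Fin q → ℕ
      ι d = ⟦ does (c Fin.≟ d) ⟧
      ℓ′ d = ℓ d ∸ ι d
      ∑ι : ∑ (allFin q) ι ≡ 1
      ∑ι = ∑-one-hot c
      ι≤ℓ : ∀ d → ι d ≤ ℓ d
      ι≤ℓ d with c Fin.≟ d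
      ... | yes refl = 0<ℓc
      ... | no  _    = z≤n
      ♯p′ : ♯ p ≡ ♯ (p ∖ t) + 1
      ♯p′ = trans (♯-cong λ u → sym (∧-identityʳ (p u)))
              (trans (♯-∖ p t pt (λ _ → true)) (cong (_+ 1) (♯-cong λ u → ∧-identityʳ _)))
      ∑ℓ′ : ∑ (allFin q) ℓ′ ≡ ♯ (p ∖ t)
      ∑ℓ′ = +-cancelʳ-≡ 1 _ _ (trans (cong (∑ (allFin q) ℓ′ +_) (sym ∑ι)) (trans (sym (∑-+ (allFin q) ℓ′ ι))
              (trans (∑-cong (allFin q) λ d → m∸n+n≡m (ι≤ℓ d)) (trans eq ♯p′))))
      IH : Σ (T → Fin q) λ f → ∀ c → cnt (p ∖ t) f c ≡ ℓ′ c
      IH = go N (p ∖ t) ℓ′ (suc-injective (trans (+-comm 1 _) (trans (sym ♯p′) ♯p≡))) ∑ℓ′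
      f : T → Fin q
      f u = if does (u ≟ t) then c else proj₁ IH u
      counts : ∀ d → cnt p f d ≡ ℓ d
      counts d = trans (♯-∖ p t pt (λ u → does (f u Fin.≟ d))) (trans (cong₂ _+_
        (trans (♯-cong same) (proj₂ IH d)) (cong (λ e → ⟦ does (e Fin.≟ d) ⟧) (if-true (≟-refl t)))) (m∸n+n≡m (ι≤ℓ d)))
        where
        same : ∀ u → (p ∖ t) u ∧ does (f u Fin.≟ d) ≡ (p ∖ t) u ∧ does (proj₁ IH u Fin.≟ d)
        same u with does (u ≟ t)
        ... | true  rewrite ∧-zeroʳ (p u) = refl
        ... | false = refl

distinct : ∀ {n} → Fin n → Fin n → ℕ
distinct u w = ⟦ not (does (w Fin.≟ u)) ⟧

below : ∀ {n} → Fin n → Fin n → ℕ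
below u w = ⟦ does (u Fin.<? w) ⟧

distinct-below : ∀ {n} (u w : Fin n) → distinct u w ≡ below u w + below w u
distinct-below u w with Fin.<-cmp u w
... | tri< u<w u≢w w≮u rewrite dec-false (w Fin.≟ u) (u≢w ∘ sym) | dec-true (u Fin.<? w) u<w | dec-false (w Fin.<? u) w≮u = refl
... | tri≈ u≮w u≡w w≮u rewrite dec-true (w Fin.≟ u) (sym u≡w) | dec-false (u Fin.<? w) u≮w | dec-false (w Fin.<? u) w≮u = refl
... | tri> u≮w u≢w w<u rewrite dec-false (w Fin.≟ u) (u≢w ∘ sym) | dec-false (u Fin.<? w) u≮w | dec-true (w Fin.<? u) w<u = refl

handshake : ∀ {n} (F : Fin n → Fin n → ℕ) → (∀ u w → F u w ≡ F w u) →
  ∑ (allFin n) (λ u → ∑ (allFin n) λ w → distinct u w * F u w) ≡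
  2 * ∑ (allFin n) (λ u → ∑ (allFin n) λ w → below u w * F u w)
handshake {n} F F-sym = begin
  ∑∑ (λ u w → distinct u w * F u w)              ≡⟨ (∑-cong V λ u → trans (∑-cong V (split u)) (∑-+ V _ _)) ⟩
  ∑ V (λ u → ∑ V (h u) + ∑ V (λ w → h w u))      ≡⟨ ∑-+ V _ _ ⟩
  ∑∑ h + ∑∑ (λ u w → h w u)                      ≡⟨ cong (∑∑ h +_) (∑-swap V V (λ u w → h w u)) ⟩
  ∑∑ h + ∑∑ h                                    ≡⟨ cong (∑∑ h +_) (sym (+-identityʳ _)) ⟩
  2 * ∑∑ h                                       ∎
  where
  open ≡-Reasoning
  V = allFin n
  ∑∑ : (Fin n → Fin n → ℕ) → ℕ
  ∑∑ G = ∑ V λ u → ∑ V (G u)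
  h : Fin n → Fin n → ℕ
  h u w = below u w * F u w
  split : ∀ u w → distinct u w * F u w ≡ h u w + h w u
  split u w = trans (cong (_* F u w) (distinct-below u w)) (trans (*-distribʳ-+ (F u w) (below u w) _)
    (cong (λ z → h u w + below w u * z) (F-sym u w)))

∑-distinct : ∀ {n} (v : Fin n) (f : Fin n → ℕ) →
  ∑ (allFin n) (λ w → distinct v w * f w) + f v ≡ ∑ (allFin n) f
∑-distinct {n} v f = begin
  ∑ V (λ w → distinct v w * f w) + f v          ≡⟨ cong (∑ V (λ w → distinct v w * f w) +_) (sym (Count.∑-δ (finite-Fin n) v f)) ⟩
  _                                             ≡⟨ sym (∑-+ V _ _) ⟩
  _                                             ≡⟨ ∑-cong V pt ⟩
  ∑ V f                                         ∎
  where
  open ≡-Reasoning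
  V = allFin n
  pt : ∀ w → distinct v w * f w + ⟦ does (w Fin.≟ v) ⟧ * f w ≡ f w
  pt w with does (w Fin.≟ v)
  ... | true  = +-identityʳ (f w)
  ... | false = trans (+-identityʳ _) (+-identityʳ (f w))

length-allFin : ∀ n → length (allFin n) ≡ n
length-allFin n = length-tabulate {n = n} id

module DegreeSums (n lam q : ℕ) where
  open Degrees n lam q

  mult-sym : ∀ {col} → Symmetric col → ∀ c u w → mult col c u w ≡ mult col c w u
  mult-sym col-sym c u w = ∑-cong (allFin lam) λ k → cong (λ d → ⟦ does (d Fin.≟ c) ⟧) (col-sym u w k)

  degree-mult : ∀ col c v → degree col c v ≡ ∑ (allFin n) λ w → distinct v w * mult col c v w
  degree-mult col c v = trans (∑-product (allFin n) (allFin lam) _) (∑-cong (allFin n) λ w →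
    trans (∑-cong (allFin lam) λ k → ⟦∧⟧ (not (does (w Fin.≟ v))) _) (∑-*ˡ (allFin lam) (distinct v w) _))

  ∑-mult : ∀ col u w → ∑ (allFin q) (λ c → mult col c u w) ≡ lam
  ∑-mult col u w = trans (∑-swap (allFin q) (allFin lam) _) (trans (∑-cong (allFin lam) λ k → ∑-one-hot (col u w k))
    (trans (∑-const (allFin lam) 1) (trans (*-identityʳ _) (length-allFin lam))))

  -- The extra `lam` stands for the missing loops at `v` and avoids a predecessor of `n`.
  ∑-degree : ∀ col v → ∑ (allFin q) (λ c → degree col c v) + lam ≡ n * lam
  ∑-degree col v = begin
    ∑ (allFin q) (λ c → degree col c v) + lam
      ≡⟨ cong (_+ lam) (∑-cong (allFin q) λ c → degree-mult col c v) ⟩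
    ∑ (allFin q) (λ c → ∑ (allFin n) λ w → distinct v w * mult col c v w) + lam
      ≡⟨ cong (_+ lam) (∑-swap (allFin q) (allFin n) _) ⟩
    ∑ (allFin n) (λ w → ∑ (allFin q) λ c → distinct v w * mult col c v w) + lam
      ≡⟨ cong (_+ lam) (∑-cong (allFin n) λ w → trans (∑-*ˡ (allFin q) (distinct v w) _) (cong (distinct v w *_) (∑-mult col v w))) ⟩
    ∑ (allFin n) (λ w → distinct v w * lam) + lam
      ≡⟨ ∑-distinct v (λ _ → lam) ⟩
    ∑ (allFin n) (λ _ → lam)
      ≡⟨ trans (∑-const (allFin n) lam) (cong (_* lam) (length-allFin n)) ⟩
    n * lam ∎
    where open ≡-Reasoning

  degree-sum-even : ∀ {col} → Symmetric col → ∀ c → 2 ∣ ∑ (allFin n) (degree col c)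
  degree-sum-even {col} col-sym c = divides
    (∑ (allFin n) λ u → ∑ (allFin n) λ w → below u w * mult col c u w)
    (trans (∑-cong (allFin n) (degree-mult col c))
    (trans (handshake (mult col c) (mult-sym col-sym c)) (*-comm 2 (∑ (allFin n) λ u → ∑ (allFin n) λ w → below u w * mult col c u w))))

module Start (n lam q : ℕ) (old : Fin n → Bool) (P : Colouring n lam q) (s : ℕ) (c₀ : Fin q) (E ρ : Fin q → ℕ) where
  open Degrees n lam q
  open DegreeSums n lam q
  open Balancing n lam q old P s

  triples : Finite (Fin n × Slot)
  triples = finite-× (finite-Fin n) slots

  new : Fin n → Bool
  new = not ∘ old

  new-pair : Fin n × Slot → Bool
  new-pair (u , w , k) = does (u Fin.<? w) ∧ (new u ∧ new w)

  V : List (Fin n)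
  V = allFin n

  m : ℕ
  m = ∑ V λ u → ⟦ old u ⟧

  -- The quotas for colour c are `s ∸ ρ c` edges from each old vertex to the new ones and `E c`
  -- edges among the new ones. Two hypotheses say that they exhaust the available edges, the last
  -- that the degree sum is right. Individual degrees at new vertices are left to balancing.
  start : Symmetric P → (∀ c → ρ c ≤ s) →
    (∀ c u → old u ≡ true →
      ♯ (λ t → not (does (proj₁ t Fin.≟ u)) ∧ (old (proj₁ t) ∧ does (P u (proj₁ t) (proj₂ t) Fin.≟ c))) ≡ ρ c) →
    ∑ (allFin q) (λ c → s ∸ ρ c) ≡ ♯ (new ∘ proj₁) →
    ∑ (allFin q) E ≡ Count.♯ triples new-pair →
    (∀ c → m * s + (m * (s ∸ ρ c) + 2 * E c) ≡ n * s) →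
    Σ Col Partial
  start P-sym ρ≤s P-degree ∑ℓ ∑E totals = col , record
    { col-sym = col-sym ; agree = λ u v k ou ov _ → col-oo k ou ov ; old-degree = λ c u → degree-old c ; total = total }
    where
    ℓ : Fin q → ℕ
    ℓ c = s ∸ ρ c

    F : Σ (Slot → Fin q) λ f → ∀ c → cnt (new ∘ proj₁) f c ≡ ℓ c
    F = fill slots c₀ (new ∘ proj₁) ℓ ∑ℓ
    f = proj₁ F

    G : Σ (Fin n × Slot → Fin q) λ g → ∀ c → Trail.cnt triples Fin._≟_ new-pair g c ≡ E c
    G = fill triples c₀ new-pair E ∑E
    g = proj₁ G

    col : Col
    -- The colour of an edge between an old and a new vertex depends on the new end and `k` only, so
    -- one filling `f` serves all old vertices. Among new vertices `g` is read at the ordered pair,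
    -- which gives symmetry.
    col u v k = if old u then (if old v then P u v k else f (v , k))
                else (if old v then f (u , k) else (if does (u Fin.<? v) then g (u , v , k) else g (v , u , k)))

    col-oo : ∀ {u v} k → old u ≡ true → old v ≡ true → col u v k ≡ P u v k
    col-oo k ou ov = trans (if-true ou) (if-true ov)
    col-on : ∀ {u v} k → old u ≡ true → old v ≡ false → col u v k ≡ f (v , k)
    col-on k ou nv = trans (if-true ou) (if-false nv)
    col-no : ∀ {u v} k → old u ≡ false → old v ≡ true → col u v k ≡ f (u , k)
    col-no k nu ov = trans (if-false nu) (if-true ov)
    col-nn : ∀ {u v} k → old u ≡ false → old v ≡ false → does (u Fin.<? v) ≡ true → col u v k ≡ g (u , v , k)
    col-nn k nu nv lt = trans (if-false nu) (trans (if-false nv) (if-true lt))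
    col-nn′ : ∀ {u v} k → old u ≡ false → old v ≡ false → does (v Fin.<? u) ≡ false → col v u k ≡ g (u , v , k)
    col-nn′ k nu nv lt = trans (if-false nv) (trans (if-false nu) (if-false lt))

    col-sym : Symmetric col
    col-sym u v k = at (old u) refl (old v) refl
      where
      at : ∀ b → old u ≡ b → ∀ b′ → old v ≡ b′ → col u v k ≡ col v u k
      at true  ou true  ov = trans (col-oo k ou ov) (trans (P-sym u v k) (sym (col-oo k ov ou)))
      at true  ou false nv = trans (col-on k ou nv) (sym (col-no k nv ou))
      at false nu true  ov = trans (col-no k nu ov) (sym (col-on k ov nu))
      at false nu false nv with Fin.<-cmp u v
      ... | tri< u<v _ v≮u = trans (col-nn k nu nv (dec-true (u Fin.<? v) u<v)) (sym (col-nn′ k nu nv (dec-false (v Fin.<? u) v≮u)))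
      ... | tri≈ _ refl _  = refl
      ... | tri> u≮v _ v<u = trans (col-nn′ k nv nu (dec-false (u Fin.<? v) u≮v)) (sym (col-nn k nv nu (dec-true (v Fin.<? u) v<u)))

    degree-old : ∀ c {u} → old u ≡ true → degree col c u ≡ s
    degree-old c {u} ou = trans (∑-cong (Finite.elems slots) pt) (trans (∑-+ (Finite.elems slots) _ _)
        (trans (cong₂ _+_ (P-degree c u ou) (proj₂ F c)) (m+[n∸m]≡n (ρ≤s c))))
      where
      pt : ∀ t → ⟦ not (does (proj₁ t Fin.≟ u)) ∧ does (row col u t Fin.≟ c) ⟧ ≡
        ⟦ not (does (proj₁ t Fin.≟ u)) ∧ (old (proj₁ t) ∧ does (row P u t Fin.≟ c)) ⟧ + ⟦ new (proj₁ t) ∧ does (f t Fin.≟ c) ⟧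
      pt (w , k) = at (old w) refl
        where
        at : ∀ b → old w ≡ b → ⟦ not (does (w Fin.≟ u)) ∧ does (col u w k Fin.≟ c) ⟧ ≡
          ⟦ not (does (w Fin.≟ u)) ∧ (old w ∧ does (P u w k Fin.≟ c)) ⟧ + ⟦ new w ∧ does (f (w , k) Fin.≟ c) ⟧
        at true ow = trans (cong (λ d → ⟦ not (does (w Fin.≟ u)) ∧ does (d Fin.≟ c) ⟧) (col-oo k ou ow))
          (trans (sym (+-identityʳ _)) (cong (λ b → ⟦ not (does (w Fin.≟ u)) ∧ (b ∧ does (P u w k Fin.≟ c)) ⟧ + ⟦ not b ∧ does (f (w , k) Fin.≟ c) ⟧) (sym ow)))
        at false nw = trans (cong₂ (λ b d → ⟦ not b ∧ does (d Fin.≟ c) ⟧) (dec-false (w Fin.≟ u) λ { refl → true≢false ou nw }) (col-on k ou nw))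
          (trans (cong (λ b → ⟦ b ⟧ + ⟦ does (f (w , k) Fin.≟ c) ⟧) (sym (∧-zeroʳ (not (does (w Fin.≟ u))))))
            (cong (λ b → ⟦ not (does (w Fin.≟ u)) ∧ (b ∧ does (P u w k Fin.≟ c)) ⟧ + ⟦ not b ∧ does (f (w , k) Fin.≟ c) ⟧) (sym nw)))

    -- The degree sum is split into the old vertices, the edges from new to old ones (`m` copies of
    -- `f`) and the edges among new ones, each counted twice.
    total : ∀ c → ∑ V (degree col c) ≡ ∑ V λ _ → s
    total c = begin
      ∑ V (degree col c) ≡⟨ ∑-cong V old-new ⟩
      ∑ V (λ u → o u * s + (ν u * (m * μ u) + ∑ V λ w → distinct u w * N u w)) ≡⟨ ∑-+ V _ _ ⟩
      ∑ V (λ u → o u * s) + ∑ V (λ u → ν u * (m * μ u) + ∑ V λ w → distinct u w * N u w)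
        ≡⟨ cong₂ _+_ (∑-*ʳ V s o) (∑-+ V _ _) ⟩
      m * s + (∑ V (λ u → ν u * (m * μ u)) + ∑ V (λ u → ∑ V λ w → distinct u w * N u w))
        ≡⟨ cong (m * s +_) (cong₂ _+_ cross (trans (handshake N N-sym) (cong (2 *_) inside))) ⟩
      m * s + (m * ℓ c + 2 * E c) ≡⟨ totals c ⟩
      n * s ≡⟨ sym (trans (∑-const V s) (cong (_* s) (length-allFin n))) ⟩
      ∑ V (λ _ → s) ∎
      where
      open ≡-Reasoning
      o ν μ : Fin n → ℕ
      o u = ⟦ old u ⟧
      ν u = ⟦ new u ⟧
      μ u = ∑ (allFin lam) λ k → ⟦ does (f (u , k) Fin.≟ c) ⟧
      M N : Fin n → Fin n → ℕ
      M = mult col c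
      N u w = ν u * ν w * M u w
      N-sym : ∀ u w → N u w ≡ N w u
      N-sym u w = cong₂ _*_ (*-comm (ν u) (ν w)) (mult-sym col-sym c u w)
      ν-true : ∀ {u} → old u ≡ false → ν u ≡ 1
      ν-true nu = cong (λ b → ⟦ not b ⟧) nu
      ν-false : ∀ {u} → old u ≡ true → ν u ≡ 0
      ν-false ou = cong (λ b → ⟦ not b ⟧) ou
      split : ∀ u → old u ≡ false → ∀ w → distinct u w * M u w ≡ o w * μ u + distinct u w * N u w
      split u nu w = at (old w) refl
        where
        at : ∀ b → old w ≡ b → distinct u w * M u w ≡ o w * μ u + distinct u w * N u w
        at true ow = begin
          distinct u w * M u w ≡⟨ cong₂ _*_ (cong (λ b → ⟦ not b ⟧) (dec-false (w Fin.≟ u) λ { refl → true≢false ow nu }))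
                                    (∑-cong (allFin lam) λ k → cong (λ d → ⟦ does (d Fin.≟ c) ⟧) (col-no k nu ow)) ⟩
          1 * μ u              ≡⟨ sym (+-identityʳ _) ⟩
          1 * μ u + 0          ≡⟨ cong₂ (λ b z → b * μ u + z) (sym (cong ⟦_⟧ ow)) (sym zeroN) ⟩
          o w * μ u + distinct u w * N u w ∎
          where
          zeroN : distinct u w * N u w ≡ 0
          zeroN = trans (cong (λ z → distinct u w * (z * M u w)) (trans (cong (ν u *_) (ν-false ow)) (*-zeroʳ (ν u)))) (*-zeroʳ (distinct u w))
        at false nw = cong₂ (λ z b → b * μ u + distinct u w * z)
          (trans (sym (+-identityʳ (M u w))) (cong₂ (λ a b → a * b * M u w) (sym (ν-true nu)) (sym (ν-true nw)))) (sym (cong ⟦_⟧ nw))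
      old-new : ∀ u → degree col c u ≡ o u * s + (ν u * (m * μ u) + ∑ V λ w → distinct u w * N u w)
      old-new u = at (old u) refl
        where
        at : ∀ b → old u ≡ b → degree col c u ≡ o u * s + (ν u * (m * μ u) + ∑ V λ w → distinct u w * N u w)
        at true ou = trans (degree-old c ou) (trans (arith s) (cong₂ _+_ (cong (_* s) (sym (cong ⟦_⟧ ou)))
          (cong₂ _+_ (cong (_* (m * μ u)) (sym (ν-false ou)))
            (sym (∑-zero V λ w → trans (cong (λ z → distinct u w * (z * ν w * M u w)) (ν-false ou)) (*-zeroʳ (distinct u w)))))))
          where
          arith : ∀ s → s ≡ 1 * s + (0 + 0)
          arith = solve-∀
        at false nu = begin
          degree col c u ≡⟨ degree-mult col c u ⟩
          ∑ V (λ w → distinct u w * M u w) ≡⟨ ∑-cong V (split u nu) ⟩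
          ∑ V (λ w → o w * μ u + distinct u w * N u w) ≡⟨ ∑-+ V _ _ ⟩
          ∑ V (λ w → o w * μ u) + ∑ V (λ w → distinct u w * N u w) ≡⟨ cong (_+ ∑ V (λ w → distinct u w * N u w)) (trans (∑-*ʳ V (μ u) o) (sym (+-identityʳ _))) ⟩
          1 * (m * μ u) + ∑ V (λ w → distinct u w * N u w) ≡⟨ cong₂ (λ a b → a * s + (b * (m * μ u) + ∑ V (λ w → distinct u w * N u w))) (sym (cong ⟦_⟧ nu)) (sym (ν-true nu)) ⟩
          _ ∎
      cross : ∑ V (λ u → ν u * (m * μ u)) ≡ m * ℓ c
      cross = begin
        ∑ V (λ u → ν u * (m * μ u)) ≡⟨ ∑-cong V (λ u → *-left-comm (ν u) m (μ u)) ⟩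
        ∑ V (λ u → m * (ν u * μ u)) ≡⟨ ∑-*ˡ V m _ ⟩
        m * ∑ V (λ u → ν u * μ u)   ≡⟨ cong (m *_) (∑-cong V λ u → trans (sym (∑-*ˡ (allFin lam) (ν u) _)) (∑-cong (allFin lam) λ k → sym (⟦∧⟧ (new u) _))) ⟩
        _                           ≡⟨ cong (m *_) (trans (sym (∑-product V (allFin lam) _)) (proj₂ F c)) ⟩
        m * ℓ c ∎
      inside : ∑ V (λ u → ∑ V λ w → below u w * N u w) ≡ E c
      inside = trans (∑-cong V λ u → trans (∑-cong V λ w → at u w (old u) refl (old w) refl _ refl)
                                      (sym (∑-product V (allFin lam) _)))
                 (trans (sym (∑-product V (Finite.elems slots) _)) (proj₂ G c))
        where
        Goal : Fin n → Fin n → Set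
        Goal u w = below u w * N u w ≡ ∑ (allFin lam) λ k → ⟦ (does (u Fin.<? w) ∧ (new u ∧ new w)) ∧ does (g (u , w , k) Fin.≟ c) ⟧
        none : ∀ u w → below u w * (ν u * ν w) ≡ 0 → does (u Fin.<? w) ∧ (new u ∧ new w) ≡ false → Goal u w
        none u w z e = trans (sym (*-assoc (below u w) _ _)) (trans (cong (_* M u w) z)
          (sym (∑-zero (allFin lam) λ k → cong (λ b → ⟦ b ∧ does (g (u , w , k) Fin.≟ c) ⟧) e)))
        at : ∀ u w b → old u ≡ b → ∀ b′ → old w ≡ b′ → ∀ b″ → does (u Fin.<? w) ≡ b″ → Goal u w
        at u w true ou _ _ _ _ = none u w (trans (cong (λ z → below u w * (z * ν w)) (ν-false ou)) (*-zeroʳ (below u w)))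
          (trans (cong (λ b → does (u Fin.<? w) ∧ (not b ∧ new w)) ou) (∧-zeroʳ _))
        at u w false nu true ow _ _ = none u w
          (trans (cong (λ z → below u w * z) (trans (cong (ν u *_) (ν-false ow)) (*-zeroʳ (ν u)))) (*-zeroʳ (below u w)))
          (trans (cong (does (u Fin.<? w) ∧_) (trans (cong (λ b → new u ∧ not b) ow) (∧-zeroʳ (new u)))) (∧-zeroʳ _))
        at u w false nu false nw false ge = none u w (cong (λ b → ⟦ b ⟧ * (ν u * ν w)) ge) (cong (_∧ (new u ∧ new w)) ge)
        at u w false nu false nw true lt = trans
          (cong₂ _*_ (cong ⟦_⟧ lt) (cong (_* M u w) (cong₂ _*_ (ν-true nu) (ν-true nw))))
          (trans (one (M u w)) (∑-cong (allFin lam) λ k → cong₂ (λ b d → ⟦ b ∧ does (d Fin.≟ c) ⟧)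
            (sym (cong₂ _∧_ lt (cong₂ (λ a b → not a ∧ not b) nu nw))) (col-nn k nu nw lt)))
          where
          one : ∀ a → 1 * (1 * 1 * a) ≡ a
          one = solve-∀

-- The old vertices as an initial segment, and restriction to them.

module Embedding (m n lam : ℕ) (m≤n : m ≤ n) where

  old : Fin n → Bool
  old v = does (toℕ v <? m)

  ι : Fin m → Fin n
  ι i = inject≤ i m≤n

  o ν : Fin n → ℕ
  o v = ⟦ old v ⟧
  ν v = ⟦ not (old v) ⟧

  old-ι : ∀ i → old (ι i) ≡ true
  old-ι i = dec-true (toℕ (ι i) <? m) (subst (_< m) (sym (Fin.toℕ-inject≤ i m≤n)) (Fin.toℕ<n i))

  ι-injective : ∀ {i j} → ι i ≡ ι j → i ≡ j
  ι-injective = Fin.inject≤-injective m≤n m≤n _ _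

  old⇒ι : ∀ {v} → old v ≡ true → ∃ λ i → ι i ≡ v
  old⇒ι {v} ov = fromℕ< v<m , Fin.toℕ-injective (trans (Fin.toℕ-inject≤ _ m≤n) (Fin.toℕ-fromℕ< v<m))
    where v<m = does⁻¹ (toℕ v <? m) ov

  ∑-old : ∀ f → ∑ (allFin n) (λ w → o w * f w) ≡ ∑ (allFin m) (f ∘ ι)
  ∑-old = go m n m≤n
    where
    go : ∀ m n (m≤n : m ≤ n) (f : Fin n → ℕ) →
      ∑ (allFin n) (λ w → ⟦ does (toℕ w <? m) ⟧ * f w) ≡ ∑ (allFin m) (λ i → f (inject≤ i m≤n))
    go zero    n       _   f = ∑-zero (allFin n) λ _ → refl
    go (suc m) (suc n) m≤n f = trans (∑-suc n (λ w → ⟦ does (toℕ w <? suc m) ⟧ * f w))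
      (trans (cong₂ _+_ (+-identityʳ (f zero)) (go m n (s≤s⁻¹ m≤n) (f ∘ suc))) (sym (∑-suc m (λ i → f (inject≤ i m≤n)))))

  ∑-o : ∑ (allFin n) o ≡ m
  ∑-o = trans (∑-cong (allFin n) λ w → sym (*-identityʳ (o w))) (trans (∑-old (λ _ → 1))
    (trans (∑-const (allFin m) 1) (trans (*-identityʳ _) (length-allFin m))))

  o+ν : ∀ w → o w + ν w ≡ 1
  o+ν w with old w
  ... | true  = refl
  ... | false = refl

  ∑-old-new : ∀ f → ∑ (allFin n) f ≡ ∑ (allFin n) (λ w → o w * f w) + ∑ (allFin n) (λ w → ν w * f w)
  ∑-old-new f = trans (∑-cong (allFin n) pt) (∑-+ (allFin n) _ _)
    where
    pt : ∀ w → f w ≡ o w * f w + ν w * f w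
    pt w = trans (sym (+-identityʳ (f w))) (trans (cong (_* f w) (sym (o+ν w))) (*-distribʳ-+ (f w) (o w) (ν w)))

  ∑-ν : m + ∑ (allFin n) ν ≡ n
  ∑-ν = begin
    m + ∑ (allFin n) ν                    ≡⟨ cong (_+ ∑ (allFin n) ν) (sym ∑-o) ⟩
    ∑ (allFin n) o + ∑ (allFin n) ν       ≡⟨ sym (∑-+ (allFin n) o ν) ⟩
    ∑ (allFin n) (λ w → o w + ν w)        ≡⟨ ∑-cong (allFin n) o+ν ⟩
    ∑ (allFin n) (λ _ → 1)                ≡⟨ trans (∑-const (allFin n) 1) (trans (*-identityʳ _) (length-allFin n)) ⟩
    n                                     ∎
    where open ≡-Reasoning

  distinct-ι : ∀ i j → distinct (ι i) (ι j) ≡ distinct i j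
  distinct-ι i j = cong (λ b → ⟦ not b ⟧) (bool-≡
    (λ h → dec-true (j Fin.≟ i) (ι-injective (does⁻¹ (ι j Fin.≟ ι i) h)))
    (λ h → dec-true (ι j Fin.≟ ι i) (cong ι (does⁻¹ (j Fin.≟ i) h))))

  module Restriction {q Q} (colF : Colouring m lam q) (col : Colouring n lam Q) (φ : Fin q → Fin Q)
    (φ-injective : Injective _≡_ _≡_ φ)
    (ext : ∀ i j k → i ≢ j → col (ι i) (ι j) k ≡ φ (colF i j k)) where
    module DF = Degrees m lam q
    module DG = Degrees n lam Q

    old-degree : Fin Q → Fin n → ℕ
    old-degree c v = ∑ (allFin n) λ w → o w * (distinct v w * DG.mult col c v w)

    new-degree : Fin Q → Fin n → ℕ
    new-degree c v = ∑ (allFin n) λ w → ν w * (distinct v w * DG.mult col c v w)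

    degree-old-new : ∀ c v → DG.degree col c v ≡ old-degree c v + new-degree c v
    degree-old-new c v = trans (DegreeSums.degree-mult n lam Q col c v) (∑-old-new _)

    distinct-zero : ∀ {i j : Fin m} → i ≡ j → ∀ a → distinct i j * a ≡ 0
    distinct-zero {i} refl a = cong (λ b → ⟦ not b ⟧ * a) (dec-true (i Fin.≟ i) refl)

    old-degree-ι : ∀ c i → old-degree c (ι i) ≡ ∑ (allFin m) λ j → distinct i j * ∑ (allFin lam) λ k → ⟦ does (φ (colF i j k) Fin.≟ c) ⟧
    old-degree-ι c i = trans (∑-old _) (∑-cong (allFin m) λ j → at j (i Fin.≟ j))
      where
      at : ∀ j → Dec (i ≡ j) → distinct (ι i) (ι j) * DG.mult col c (ι i) (ι j) ≡ distinct i j * ∑ (allFin lam) λ k → ⟦ does (φ (colF i j k) Fin.≟ c) ⟧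
      at j (yes i≡j) = trans (cong (_* DG.mult col c (ι i) (ι j)) (distinct-ι i j)) (trans (distinct-zero i≡j _) (sym (distinct-zero i≡j _)))
      at j (no i≢j)  = cong₂ _*_ (distinct-ι i j) (∑-cong (allFin lam) λ k → cong (λ d → ⟦ does (d Fin.≟ c) ⟧) (ext i j k i≢j))

    -- Injectivity of `φ` keeps the edges of other given factors out of this colour.
    old-degree-φ : ∀ c i → old-degree (φ c) (ι i) ≡ DF.degree colF c i
    old-degree-φ c i = trans (old-degree-ι (φ c) i) (trans
      (∑-cong (allFin m) λ j → cong (distinct i j *_) (∑-cong (allFin lam) λ k → cong ⟦_⟧ (bool-≡
        (λ h → dec-true (colF i j k Fin.≟ c) (φ-injective (does⁻¹ (φ (colF i j k) Fin.≟ φ c) h)))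
        (λ h → dec-true (φ (colF i j k) Fin.≟ φ c) (cong φ (does⁻¹ (colF i j k Fin.≟ c) h))))))
      (sym (DegreeSums.degree-mult m lam q colF c i)))

    old-degree-∉ : ∀ {c} → (∀ a → φ a ≢ c) → ∀ i → old-degree c (ι i) ≡ 0
    old-degree-∉ {c} c∉ i = trans (old-degree-ι c i) (∑-zero (allFin m) λ j →
      trans (cong (distinct i j *_) (∑-zero (allFin lam) λ k → cong ⟦_⟧ (dec-false (φ (colF i j k) Fin.≟ c) (c∉ _)))) (*-zeroʳ (distinct i j)))

-- Necessity.

scaled : ∀ l x a b c → l * x ≡ a * b → l * (c * x) ≡ a * (b * c)
scaled l x a b c eq = trans (*-left-comm l c x) (trans (cong (c *_) eq)
  (trans (*-comm c (a * b)) (*-assoc a b c)))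

factors-count : ∀ {n lam r} (F : Factorization n lam r) → Fin n → lam * (n ∸ 1) ≡ Factorization.q F * r
factors-count {suc n} {lam} {r} F v = +-cancelʳ-≡ lam _ _ (begin
  lam * n + lam                           ≡⟨ arith lam n ⟩
  suc n * lam                             ≡⟨ sym (DegreeSums.∑-degree (suc n) lam q col v) ⟩
  ∑ (allFin q) (λ c → degree col c v) + lam ≡⟨ cong (_+ lam) (∑-cong (allFin q) λ c → trans (sym (deg≡degree col c v)) (regular c v)) ⟩
  ∑ (allFin q) (λ _ → r) + lam            ≡⟨ cong (_+ lam) (trans (∑-const (allFin q) r) (cong (_* r) (length-allFin q))) ⟩
  q * r + lam                             ∎)
  where
  open ≡-Reasoning
  open Factorization F hiding (sym)
  open Degrees (suc n) lam q
  arith : ∀ a b → a * b + a ≡ suc b * a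
  arith = solve-∀

factorization⇒admissible : ∀ {n lam r} (F : Factorization n lam r) → Fin n → Fin (Factorization.q F) → Admissible n r lam
factorization⇒admissible {n} {lam} {r} F v c = even , divides q (factors-count F v)
  where
  open Factorization F renaming (sym to col-sym)
  open Degrees n lam q
  even : 2 ∣ r * n
  even = subst (2 ∣_) (trans (∑-cong (allFin n) λ u → trans (sym (deg≡degree col c u)) (regular c u))
    (trans (∑-const (allFin n) r) (trans (cong (_* r) (length-allFin n)) (*-comm n r))))
    (DegreeSums.degree-sum-even n lam q {col} col-sym c)

module Necessity {m n r s lam : ℕ} (1≤s : 1 ≤ s) (1≤lam : 1 ≤ lam) (m>2 : 2 < m) (m<n : m < n)
  (F : Factorization m lam r) (X : Extends s (<⇒≤ m<n) F) where
  open Embedding m n lam (<⇒≤ m<n)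

  G : Factorization n lam s
  G = proj₁ X

  conn : Connected G
  conn = proj₁ (proj₂ X)

  open Factorization F using () renaming (q to q; col to colF)
  open Factorization G using () renaming (q to Q; col to col; sym to col-sym)

  φ : Fin q → Fin Q
  φ = proj₁ (proj₂ (proj₂ X))

  φ-injective : Injective _≡_ _≡_ φ
  φ-injective = proj₁ (proj₂ (proj₂ (proj₂ X)))

  open Restriction colF col φ φ-injective (proj₂ (proj₂ (proj₂ (proj₂ X))))

  instance
    s≢0 : NonZero s
    s≢0 = >-nonZero 1≤s
    lam≢0 : NonZero lam
    lam≢0 = >-nonZero 1≤lam

  i₀ i₁ : Fin m
  i₀ = fromℕ< (≤-trans (s≤s z≤n) m>2)
  i₁ = fromℕ< (≤-trans (s≤s (s≤s z≤n)) m>2)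

  c₀ : Fin q
  c₀ = colF i₀ i₁ (fromℕ< 1≤lam)

  degF : ∀ c i → DF.degree colF c i ≡ r
  degF c i = trans (sym (DF.deg≡degree colF c i)) (Factorization.regular F c i)

  degG : ∀ c v → DG.degree col c v ≡ s
  degG c v = trans (sym (DG.deg≡degree col c v)) (Factorization.regular G c v)

  countF : lam * (m ∸ 1) ≡ q * r
  countF = factors-count F i₀

  countG : lam * (n ∸ 1) ≡ Q * s
  countG = factors-count G (ι i₀)

  -- Brings the number of given factors to the common multiplier `r * s`, as `rG` does for the large
  -- factors: comparing the two sides of the ratio condition is comparing `q` with `Q`.
  sF : lam * (s * (m ∸ 1)) ≡ q * (r * s)
  sF = scaled lam (m ∸ 1) q r s countF

  rG : lam * (r * (n ∸ 1)) ≡ Q * (r * s)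
  rG = trans (scaled lam (n ∸ 1) Q s r countG) (cong (Q *_) (*-comm s r))

  ratio : s * (m ∸ 1) ≤ r * (n ∸ 1)
  ratio = *-cancelˡ-≤ lam (subst₂ _≤_ (sym sF) (sym rG) (*-monoˡ-≤ (r * s) (Fin.injective⇒≤ φ-injective)))

  -- If no factor grew, an edge leaving the old vertices could have no colour φ c₀.
  r<s : r < s
  r<s with r <? s
  ... | yes lt = lt
  ... | no r≮s = contradiction (stays (old-ι i₀) (conn (φ c₀) (ι i₀) v₀)) (λ ov → true≢false ov v₀-new)
    where
    v₀ : Fin n
    v₀ = fromℕ< m<n
    v₀-new : old v₀ ≡ false
    v₀-new = dec-false (toℕ v₀ <? m) (<-irrefl refl ∘ subst (_< m) (Fin.toℕ-fromℕ< m<n))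
    no-new : ∀ i → new-degree (φ c₀) (ι i) ≡ 0
    no-new i = n≤0⇒n≡0 (+-cancelˡ-≤ r _ _ (begin
      r + new-degree (φ c₀) (ι i) ≡⟨ cong (_+ new-degree (φ c₀) (ι i)) (sym (trans (old-degree-φ c₀ i) (degF c₀ i))) ⟩
      old-degree (φ c₀) (ι i) + new-degree (φ c₀) (ι i) ≡⟨ sym (degree-old-new (φ c₀) (ι i)) ⟩
      DG.degree col (φ c₀) (ι i) ≡⟨ degG (φ c₀) (ι i) ⟩
      s ≤⟨ ≮⇒≥ r≮s ⟩
      r ≡⟨ sym (+-identityʳ r) ⟩
      r + 0 ∎))
      where open ≤-Reasoning
    edge-old : ∀ {u w} → old u ≡ true → Adj col (φ c₀) u w → old w ≡ true
    edge-old {u} {w} ou (u≢w , k , e) with old⇒ι ou | old w in ow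
    ... | _        | true  = refl
    ... | i , refl | false = contradiction (≤-trans positive (≤-reflexive (no-new i))) λ ()
      where
      positive : 1 ≤ new-degree (φ c₀) (ι i)
      positive = ≤-trans (≤-trans (≤-reflexive (cong ⟦_⟧ (sym (dec-true (col (ι i) w k Fin.≟ φ c₀) e))))
          (≤-trans (Count.term≤∑ (finite-Fin lam) (λ k → ⟦ does (col (ι i) w k Fin.≟ φ c₀) ⟧) k) (≤-reflexive (sym one))))
        (Count.term≤∑ (finite-Fin n) (λ w → ν w * (distinct (ι i) w * DG.mult col (φ c₀) (ι i) w)) w)
        where
        one : ν w * (distinct (ι i) w * DG.mult col (φ c₀) (ι i) w) ≡ DG.mult col (φ c₀) (ι i) w
        one = trans (cong₂ (λ a b → ⟦ not a ⟧ * (⟦ not b ⟧ * DG.mult col (φ c₀) (ι i) w)) ow (dec-false (w Fin.≟ ι i) (u≢w ∘ sym)))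
                (trans (+-identityʳ _) (+-identityʳ _))
    stays : ∀ {u v} → old u ≡ true → Reach col (φ c₀) u v → old v ≡ true
    stays ou Reach.here       = ou
    stays ou (Reach.step a p) = stays (edge-old ou a) p

  module Unused {c : Fin Q} (c∉ : ∀ a → φ a ≢ c) where

    -- All edges of a colour outside the image of φ that meet an old vertex lead to a new one.
    old≤new : m * s ≤ ∑ (allFin n) ν * s
    old≤new = begin
      m * s                                                    ≡⟨ cong (_* s) (sym (length-allFin m)) ⟩
      length (allFin m) * s                                    ≡⟨ sym (∑-const (allFin m) s) ⟩
      ∑ (allFin m) (λ _ → s)                                   ≡⟨ ∑-cong (allFin m) (λ i → trans (sym (degG c (ι i)))
                                                                    (trans (degree-old-new c (ι i)) (cong (_+ new-degree c (ι i)) (old-degree-∉ c∉ i)))) ⟩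
      ∑ (allFin m) (λ i → new-degree c (ι i))                  ≡⟨ sym (∑-old (new-degree c)) ⟩
      ∑ (allFin n) (λ v → o v * new-degree c v)                ≡⟨ ∑-cong (allFin n) (λ v → sym (∑-*ˡ (allFin n) (o v) _)) ⟩
      ∑ (allFin n) (λ v → ∑ (allFin n) λ w → o v * (ν w * (distinct v w * DG.mult col c v w)))
                                                               ≡⟨ ∑-swap (allFin n) (allFin n) _ ⟩
      ∑ (allFin n) (λ w → ∑ (allFin n) λ v → o v * (ν w * (distinct v w * DG.mult col c v w)))
                                                               ≤⟨ ∑-mono (allFin n) (λ w → ∑-mono (allFin n) (λ v → bound v w)) ⟩
      ∑ (allFin n) (λ w → ∑ (allFin n) λ v → ν w * (distinct w v * DG.mult col c w v))
                                                               ≡⟨ ∑-cong (allFin n) (λ w → trans (∑-*ˡ (allFin n) (ν w) _)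
                                                                    (cong (ν w *_) (trans (sym (DegreeSums.degree-mult n lam Q col c w)) (degG c w)))) ⟩
      ∑ (allFin n) (λ w → ν w * s)                             ≡⟨ ∑-*ʳ (allFin n) s ν ⟩
      ∑ (allFin n) ν * s                                       ∎
      where
      open ≤-Reasoning
      distinct-sym : ∀ (u w : Fin n) → distinct u w ≡ distinct w u
      distinct-sym u w = trans (distinct-below u w) (trans (+-comm (below u w) _) (sym (distinct-below w u)))
      bound : ∀ v w → o v * (ν w * (distinct v w * DG.mult col c v w)) ≤ ν w * (distinct w v * DG.mult col c w v)
      bound v w with old v
      ... | false = z≤n
      ... | true  = ≤-reflexive (trans (+-identityʳ _)
        (cong (ν w *_) (cong₂ _*_ (distinct-sym v w) (DegreeSums.mult-sym n lam Q {col} col-sym c v w))))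

    2m≤n : 2 * m ≤ n
    2m≤n = subst₂ _≤_ (cong (m +_) (sym (+-identityʳ m))) ∑-ν (+-monoʳ-≤ m (*-cancelʳ-≤ m _ s old≤new))

  -- Strictness means `q < Q`, so by the pigeonhole principle `φ` misses a colour.
  strict⇒2m≤n : s * (m ∸ 1) < r * (n ∸ 1) → 2 * m ≤ n
  strict⇒2m≤n lt with Fin.any? (λ c → Fin.all? λ a → ¬? (φ a Fin.≟ c))
  ... | yes (c , c∉) = Unused.2m≤n c∉
  ... | no  onto     = contradiction (Fin.injective⇒≤ {f = ψ} ψ-injective) (<⇒≱ q<Q)
    where
    q<Q : q < Q
    q<Q = *-cancelʳ-< (r * s) q Q (subst₂ _<_ sF rG (*-monoʳ-< lam lt))
    preimage : ∀ c → ∃ λ a → φ a ≡ c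
    preimage c with Fin.any? (λ a → φ a Fin.≟ c)
    ... | yes p = p
    ... | no ¬p = contradiction (c , λ a e → ¬p (a , e)) onto
    ψ : Fin Q → Fin q
    ψ c = proj₁ (preimage c)
    ψ-injective : Injective _≡_ _≡_ ψ
    ψ-injective {c} {d} e = trans (sym (proj₂ (preimage c))) (trans (cong φ e) (proj₂ (preimage d)))

  necessity : (Admissible m r lam × Admissible n s lam) × (r < s × s * (m ∸ 1) ≤ r * (n ∸ 1)) ×
    (s * (m ∸ 1) < r * (n ∸ 1) → 2 * m ≤ n)
  necessity = (factorization⇒admissible F i₀ c₀ , factorization⇒admissible G (ι i₀) (φ c₀)) , (r<s , ratio) , strict⇒2m≤n

-- Sufficiency.

star⇒reach : ∀ {n lam q} {col : Colouring n lam q} {c u v} → Star (Adj col c) u v → Reach col c u v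
star⇒reach ε       = Reach.here
star⇒reach (a ◅ p) = Reach.step a (star⇒reach p)

-- After multiplication by b, the difference of the two sides is s (b - a) (b - a - 1).
tight-bound : ∀ {a b r s} → s * a ≡ r * b → a < b → 2 * (suc a * s) ≤ suc b * s + suc a * r
tight-bound {a} {b} {r} {s} eq a<b with m≤n⇒∃[o]m+o≡n a<b
... | d , refl = *-cancelʳ-≤ _ _ (suc (a + d)) (begin
  2 * (suc a * s) * suc (a + d)                                    ≤⟨ m≤m+n _ (s * (d * d + d)) ⟩
  2 * (suc a * s) * suc (a + d) + s * (d * d + d)                  ≡⟨ expand a d s ⟩
  suc (suc (a + d)) * s * suc (a + d) + suc a * (s * a)            ≡⟨ cong (λ z → suc (suc (a + d)) * s * suc (a + d) + suc a * z) eq ⟩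
  suc (suc (a + d)) * s * suc (a + d) + suc a * (r * suc (a + d))  ≡⟨ collect (suc (suc (a + d)) * s) (suc a) r (suc (a + d)) ⟩
  (suc (suc (a + d)) * s + suc a * r) * suc (a + d)                ∎)
  where
  open ≤-Reasoning
  expand : ∀ a d s → 2 * ((1 + a) * s) * (1 + (a + d)) + s * (d * d + d) ≡
                     (1 + (1 + (a + d))) * s * (1 + (a + d)) + (1 + a) * (s * a)
  expand = solve-∀
  collect : ∀ w x r b → w * b + x * (r * b) ≡ (w + x * r) * b
  collect = solve-∀

module Sufficiency {m n r s lam : ℕ} (1≤r : 1 ≤ r) (1≤lam : 1 ≤ lam) (m>2 : 2 < m) (m<n : m < n)
  (F : Factorization m lam r) (2∣rm : 2 ∣ r * m) (2∣sn : 2 ∣ s * n) (s∣ : s ∣ lam * (n ∸ 1))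
  (r<s : r < s) (ratio : s * (m ∸ 1) ≤ r * (n ∸ 1)) (strict : s * (m ∸ 1) < r * (n ∸ 1) → 2 * m ≤ n) where

  open Embedding m n lam (<⇒≤ m<n)
  open Factorization F using () renaming (q to q; col to colF)

  instance
    r≢0 : NonZero r
    r≢0 = >-nonZero 1≤r
    s≢0 : NonZero s
    s≢0 = >-nonZero (≤-trans (s≤s z≤n) r<s)
    rs≢0 : NonZero (r * s)
    rs≢0 = m*n≢0 r s

  1≤m : 1 ≤ m
  1≤m = ≤-trans (s≤s z≤n) m>2

  i₀ i₁ : Fin m
  i₀ = fromℕ< 1≤m
  i₁ = fromℕ< (≤-trans (s≤s (s≤s z≤n)) m>2)

  k₀ : Fin lam
  k₀ = fromℕ< 1≤lam

  Q : ℕ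
  Q = _∣_.quotient s∣

  countG : lam * (n ∸ 1) ≡ Q * s
  countG = _∣_.equality s∣

  countF : lam * (m ∸ 1) ≡ q * r
  countF = factors-count F i₀

  sF : lam * (s * (m ∸ 1)) ≡ q * (r * s)
  sF = scaled lam (m ∸ 1) q r s countF

  rG : lam * (r * (n ∸ 1)) ≡ Q * (r * s)
  rG = trans (scaled lam (n ∸ 1) Q s r countG) (cong (Q *_) (*-comm s r))

  q≤Q : q ≤ Q
  q≤Q = *-cancelʳ-≤ q Q (r * s) (subst₂ _≤_ sF rG (*-monoʳ-≤ lam ratio))

  module Colours = Embedding q Q lam q≤Q

  φ : Fin q → Fin Q
  φ = Colours.ι

  -- A left inverse of `ι`. The value `i₀` at new vertices is a default: the colours of `P` are
  -- prescribed between old vertices only.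
  π : Fin n → Fin m
  π v with toℕ v <? m
  ... | yes v<m = fromℕ< v<m
  ... | no  _   = i₀

  π-ι : ∀ i → π (ι i) ≡ i
  π-ι i with toℕ (ι i) <? m
  ... | yes lt = Fin.toℕ-injective (trans (Fin.toℕ-fromℕ< lt) (Fin.toℕ-inject≤ i (<⇒≤ m<n)))
  ... | no ¬lt = contradiction (does⁻¹ (toℕ (ι i) <? m) (old-ι i)) ¬lt

  P : Colouring n lam Q
  P u v k = φ (colF (π u) (π v) k)

  P-ι : ∀ i j k → P (ι i) (ι j) k ≡ φ (colF i j k)
  P-ι i j k = cong₂ (λ a b → φ (colF a b k)) (π-ι i) (π-ι j)

  P-sym : ∀ u v k → P u v k ≡ P v u k
  P-sym u v k = cong φ (Factorization.sym F (π u) (π v) k)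

  open Degrees n lam Q
  open Restriction colF P φ Colours.ι-injective (λ i j k _ → P-ι i j k) using (old-degree; old-degree-φ; old-degree-∉)

  -- The degree of a colour inside the given multigraph: the given factors are the first `q`
  -- colours.
  ρ : Fin Q → ℕ
  ρ c = ⟦ Colours.old c ⟧ * r

  ρ-cases : ∀ c → ρ c ≡ r ⊎ (Colours.old c ≡ false × ρ c ≡ 0)
  ρ-cases c with Colours.old c
  ... | true  = inj₁ (+-identityʳ r)
  ... | false = inj₂ (refl , refl)

  ρ<s : ∀ c → ρ c < s
  ρ<s c with ρ-cases c
  ... | inj₁ e       = subst (_< s) (sym e) r<s
  ... | inj₂ (_ , e) = subst (_< s) (sym e) (≤-trans (s≤s z≤n) r<s)

  V : List (Fin n)
  V = allFin n

  p : ℕ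
  p = ∑ V ν

  P-degree : ∀ c u → old u ≡ true →
    ♯ (λ t → not (does (proj₁ t Fin.≟ u)) ∧ (old (proj₁ t) ∧ does (P u (proj₁ t) (proj₂ t) Fin.≟ c))) ≡ ρ c
  P-degree c u ou = trans (trans (∑-product V (allFin lam) _) (∑-cong V λ w →
      trans (∑-cong (allFin lam) λ k → pt w (does (P u w k Fin.≟ c)))
        (trans (∑-*ˡ (allFin lam) (o w) _) (cong (o w *_) (∑-*ˡ (allFin lam) (distinct u w) _)))))
    (at (old⇒ι ou) (Colours.old c) refl)
    where
    pt : ∀ w b → ⟦ not (does (w Fin.≟ u)) ∧ (old w ∧ b) ⟧ ≡ o w * (distinct u w * ⟦ b ⟧)
    pt w b = trans (⟦∧⟧ (not (does (w Fin.≟ u))) _) (trans (cong (distinct u w *_) (⟦∧⟧ (old w) b)) (*-left-comm (distinct u w) (o w) ⟦ b ⟧))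
    at : ∃ (λ i → ι i ≡ u) → ∀ b → Colours.old c ≡ b → old-degree c u ≡ ρ c
    at (i , refl) false c∉ = trans (old-degree-∉ (λ a φa≡c → true≢false (trans (cong Colours.old (sym φa≡c)) (Colours.old-ι a)) c∉) i)
      (cong (λ b → ⟦ b ⟧ * r) (sym c∉))
    at (i , refl) true c∈ with Colours.old⇒ι c∈
    ... | a , refl = trans (old-degree-φ a i) (trans (sym (Degrees.deg≡degree m lam q colF a i))
      (trans (Factorization.regular F a i) (trans (sym (+-identityʳ r)) (cong (λ b → ⟦ b ⟧ * r) (sym c∈)))))

  suc-pred-m : suc (m ∸ 1) ≡ m
  suc-pred-m = m+[n∸m]≡n 1≤m

  n∸1≡ : n ∸ 1 ≡ (m ∸ 1) + p
  n∸1≡ = trans (cong (_∸ 1) (sym ∑-ν)) (+-∸-comm p 1≤m)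

  ∑ρ : ∑ (allFin Q) ρ ≡ q * r
  ∑ρ = trans (∑-*ʳ (allFin Q) r Colours.o) (cong (_* r) Colours.∑-o)

  ∑-const-Q : ∀ a → ∑ (allFin Q) (λ _ → a) ≡ Q * a
  ∑-const-Q a = trans (∑-const (allFin Q) a) (cong (_* a) (length-allFin Q))

  -- The quotas at an old vertex sum to Qs - qr = λ(n-1) - λ(m-1), the number of its edges to new
  -- vertices.
  ∑ℓ : ∑ (allFin Q) (λ c → s ∸ ρ c) ≡ p * lam
  ∑ℓ = +-cancelʳ-≡ (q * r) _ _ (begin
    ∑ (allFin Q) (λ c → s ∸ ρ c) + q * r            ≡⟨ cong (∑ (allFin Q) (λ c → s ∸ ρ c) +_) (sym ∑ρ) ⟩
    _                                               ≡⟨ sym (∑-+ (allFin Q) _ ρ) ⟩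
    ∑ (allFin Q) (λ c → (s ∸ ρ c) + ρ c)            ≡⟨ ∑-cong (allFin Q) (λ c → m∸n+n≡m (<⇒≤ (ρ<s c))) ⟩
    ∑ (allFin Q) (λ _ → s)                          ≡⟨ ∑-const-Q s ⟩
    Q * s                                           ≡⟨ sym countG ⟩
    lam * (n ∸ 1)                                   ≡⟨ cong (lam *_) n∸1≡ ⟩
    lam * ((m ∸ 1) + p)                             ≡⟨ arith lam (m ∸ 1) p ⟩
    p * lam + lam * (m ∸ 1)                         ≡⟨ cong (p * lam +_) countF ⟩
    p * lam + q * r                                 ∎)
    where
    open ≡-Reasoning
    arith : ∀ a b c → a * (b + c) ≡ c * a + a * b
    arith = solve-∀

  new-slots : ♯ (not ∘ old ∘ proj₁) ≡ p * lam
  new-slots = trans (∑-product V (allFin lam) _) (trans (∑-cong V λ w → trans (∑-const (allFin lam) (ν w))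
    (trans (cong (_* ν w) (length-allFin lam)) (*-comm lam (ν w)))) (∑-*ʳ V lam ν))

  cross-sum : ∀ c → m * s + m * (s ∸ ρ c) + m * ρ c ≡ 2 * (m * s)
  cross-sum c = trans (arith m s (s ∸ ρ c) (ρ c)) (trans (cong (λ z → m * s + m * z) (m∸n+n≡m (<⇒≤ (ρ<s c)))) (cong (m * s +_) (sym (+-identityʳ _))))
    where
    arith : ∀ a b c d → a * b + a * c + a * d ≡ a * b + a * (c + d)
    arith = solve-∀

  -- Nonnegativity of the number of inner edges. If `2 * m ≤ n` fails, the ratio condition is an
  -- equality; then `q ≡ Q`, no colour has `ρ c` zero, and `tight-bound` applies.
  enough : ∀ c → 2 * (m * s) ≤ n * s + m * ρ c
  enough c with 2 * m ≤? n
  ... | yes 2m≤n = ≤-trans (≤-reflexive (sym (*-assoc 2 m s))) (≤-trans (*-monoˡ-≤ s 2m≤n) (m≤m+n _ _))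
  ... | no ¬2m≤n = subst (λ z → 2 * (m * s) ≤ n * s + m * z) (sym ρ≡r) (subst₂ (λ a b → 2 * (a * s) ≤ b * s + a * r) suc-pred-m
      (m+[n∸m]≡n (≤-trans 1≤m (<⇒≤ m<n)))
      (tight-bound {m ∸ 1} {n ∸ 1} {r} {s} tight (∸-monoˡ-< m<n 1≤m)))
    where
    tight : s * (m ∸ 1) ≡ r * (n ∸ 1)
    tight = ≤-antisym ratio (≮⇒≥ (¬2m≤n ∘ strict))
    q≡Q : q ≡ Q
    q≡Q = *-cancelʳ-≡ q Q (r * s) (trans (sym sF) (trans (cong (lam *_) tight) rG))
    ρ≡r : ρ c ≡ r
    ρ≡r = trans (cong (λ b → ⟦ b ⟧ * r) (dec-true (toℕ c <? q) (subst (toℕ c <_) (sym q≡Q) (Fin.toℕ<n c)))) (+-identityʳ r)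

  -- The parity conditions make the remainder even: `Y + m * ρ c` is `2 * (m * s)`, and both
  -- `m * ρ c` and `n * s` are even.
  inner-edges : ∀ c → Σ ℕ λ e → m * s + (m * (s ∸ ρ c) + 2 * e) ≡ n * s
  inner-edges c = _∣_.quotient even , (begin
    m * s + (m * (s ∸ ρ c) + 2 * _∣_.quotient even) ≡⟨ sym (+-assoc (m * s) _ _) ⟩
    Y + 2 * _∣_.quotient even                       ≡⟨ cong (Y +_) (trans (*-comm 2 (_∣_.quotient even)) (sym (_∣_.equality even))) ⟩
    Y + (n * s ∸ Y)                                 ≡⟨ m+[n∸m]≡n Y≤ ⟩
    n * s                                           ∎)
    where
    open ≡-Reasoning
    Y : ℕ
    Y = m * s + m * (s ∸ ρ c)
    Y≤ : Y ≤ n * s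
    Y≤ = +-cancelʳ-≤ (m * ρ c) _ _ (≤-trans (≤-reflexive (cross-sum c)) (enough c))
    2∣mρ : 2 ∣ m * ρ c
    2∣mρ with ρ-cases c
    ... | inj₁ e       = subst (2 ∣_) (trans (*-comm r m) (cong (m *_) (sym e))) 2∣rm
    ... | inj₂ (_ , e) = divides 0 (trans (cong (m *_) e) (*-zeroʳ m))
    2∣Y : 2 ∣ Y
    2∣Y = ∣m+n∣m⇒∣n (divides (m * s) (trans (+-comm (m * ρ c) Y) (trans (cross-sum c) (*-comm 2 (m * s))))) 2∣mρ
    even : 2 ∣ n * s ∸ Y
    even = ∣m+n∣m⇒∣n (subst (2 ∣_) (trans (*-comm s n) (sym (m+[n∸m]≡n Y≤))) 2∣sn) 2∣Y

  E : Fin Q → ℕ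
  E = proj₁ ∘ inner-edges

  -- The default colour for `fill` is the colour of an edge between old vertices.
  open Start n lam Q old P s (φ (colF i₀ i₁ k₀)) E ρ using (start; triples; new-pair)

  pairs : ℕ
  pairs = Count.♯ triples new-pair

  -- The count λp(p-1) of ordered pairs, with the diagonal term moved to the left.
  2pairs : 2 * pairs + lam * p ≡ lam * (p * p)
  2pairs = begin
    2 * pairs + lam * p
      ≡⟨ cong (λ z → 2 * z + lam * p) (trans (∑-product V (Finite.elems slots) _)
           (∑-cong V λ u → trans (∑-product V (allFin lam) _) (∑-cong V λ w → pt u w))) ⟩
    2 * ∑ V (λ u → ∑ V λ w → below u w * N u w) + lam * p
      ≡⟨ cong₂ _+_ (sym (handshake N λ u w → cong (lam *_) (*-comm (ν u) (ν w)))) (sym (∑-*ˡ V lam ν)) ⟩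
    ∑ V (λ u → ∑ V λ w → distinct u w * N u w) + ∑ V (λ u → lam * ν u)
      ≡⟨ sym (∑-+ V _ _) ⟩
    ∑ V (λ u → ∑ V (λ w → distinct u w * N u w) + lam * ν u)
      ≡⟨ ∑-cong V (λ u → trans (cong (∑ V (λ w → distinct u w * N u w) +_) (cong (lam *_) (square (old u)))) (∑-distinct u (N u))) ⟩
    ∑ V (λ u → ∑ V (N u))
      ≡⟨ ∑-cong V (λ u → trans (∑-*ˡ V lam _) (cong (lam *_) (∑-*ˡ V (ν u) ν))) ⟩
    ∑ V (λ u → lam * (ν u * p))
      ≡⟨ trans (∑-*ˡ V lam _) (cong (lam *_) (∑-*ʳ V p ν)) ⟩
    lam * (p * p) ∎
    where
    open ≡-Reasoning
    N : Fin n → Fin n → ℕ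
    N u w = lam * (ν u * ν w)
    square : ∀ b → ⟦ not b ⟧ ≡ ⟦ not b ⟧ * ⟦ not b ⟧
    square true  = refl
    square false = refl
    pt : ∀ u w → ∑ (allFin lam) (λ k → ⟦ new-pair (u , w , k) ⟧) ≡ below u w * N u w
    pt u w = trans (∑-const (allFin lam) _) (trans (cong₂ _*_ (length-allFin lam)
      (trans (⟦∧⟧ (does (u Fin.<? w)) _) (cong (below u w *_) (⟦∧⟧ (not (old u)) _)))) (*-left-comm lam (below u w) (ν u * ν w)))

  -- Summing the equations that define `E` over all colours and inserting Qs = λ(n-1) shows that the
  -- inner quotas add up to the number of edges among the new vertices.
  2∑E : 2 * ∑ (allFin Q) E + lam * p ≡ lam * (p * p)
  2∑E = +-cancelˡ-≡ (m * (Q * s) + m * (p * lam)) _ _ (begin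
    m * (Q * s) + m * (p * lam) + (2 * e + lam * p)     ≡⟨ arith₁ m (Q * s) (p * lam) (2 * e) (lam * p) ⟩
    m * (Q * s) + (m * (p * lam) + 2 * e) + lam * p     ≡⟨ cong (_+ lam * p) summed ⟩
    n * (Q * s) + lam * p                               ≡⟨ cong₂ (λ a b → a * (Q * s) + b) (sym ∑-ν) (*-comm lam p) ⟩
    (m + p) * (Q * s) + p * lam                         ≡⟨ arith₂ m p (Q * s) (p * lam) ⟩
    m * (Q * s) + (p * (Q * s) + p * lam)               ≡⟨ cong (m * (Q * s) +_) (begin
        p * (Q * s) + p * lam                           ≡⟨ cong (λ z → p * z + p * lam) (trans (sym countG) (cong (lam *_) n∸1≡)) ⟩
        p * (lam * ((m ∸ 1) + p)) + p * lam             ≡⟨ arith₃ p lam (m ∸ 1) ⟩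
        suc (m ∸ 1) * (p * lam) + lam * (p * p)         ≡⟨ cong (λ z → z * (p * lam) + lam * (p * p)) suc-pred-m ⟩
        m * (p * lam) + lam * (p * p)                   ∎) ⟩
    m * (Q * s) + (m * (p * lam) + lam * (p * p))       ≡⟨ sym (+-assoc (m * (Q * s)) _ _) ⟩
    m * (Q * s) + m * (p * lam) + lam * (p * p)         ∎)
    where
    open ≡-Reasoning
    e = ∑ (allFin Q) E
    arith₁ : ∀ m x y z w → m * x + m * y + (z + w) ≡ m * x + (m * y + z) + w
    arith₁ = solve-∀
    arith₂ : ∀ m p x y → (m + p) * x + y ≡ m * x + (p * x + y)
    arith₂ = solve-∀
    arith₃ : ∀ p l a → p * (l * (a + p)) + p * l ≡ (1 + a) * (p * l) + l * (p * p)
    arith₃ = solve-∀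
    summed : m * (Q * s) + (m * (p * lam) + 2 * e) ≡ n * (Q * s)
    summed = begin
      m * (Q * s) + (m * (p * lam) + 2 * e)
        ≡⟨ cong₂ _+_ (trans (*-left-comm m Q s) (sym (∑-const-Q (m * s))))
             (cong₂ _+_ (trans (cong (m *_) (sym ∑ℓ)) (sym (∑-*ˡ (allFin Q) m _))) (sym (∑-*ˡ (allFin Q) 2 E))) ⟩
      ∑ (allFin Q) (λ _ → m * s) + (∑ (allFin Q) (λ c → m * (s ∸ ρ c)) + ∑ (allFin Q) (λ c → 2 * E c))
        ≡⟨ cong (∑ (allFin Q) (λ _ → m * s) +_) (sym (∑-+ (allFin Q) _ _)) ⟩
      ∑ (allFin Q) (λ _ → m * s) + ∑ (allFin Q) (λ c → m * (s ∸ ρ c) + 2 * E c)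
        ≡⟨ sym (∑-+ (allFin Q) _ _) ⟩
      ∑ (allFin Q) (λ c → m * s + (m * (s ∸ ρ c) + 2 * E c))
        ≡⟨ ∑-cong (allFin Q) (proj₂ ∘ inner-edges) ⟩
      ∑ (allFin Q) (λ _ → n * s)
        ≡⟨ trans (∑-const-Q (n * s)) (*-left-comm Q n s) ⟩
      n * (Q * s) ∎

  root : Fin n
  root = fromℕ< m<n

  root-new : old root ≡ false
  root-new = dec-false (toℕ root <? m) (<-irrefl refl ∘ subst (_< m) (Fin.toℕ-fromℕ< m<n))

  open Balancing n lam Q old P s
  open Connecting n lam Q old P s (≤-trans (s≤s 1≤r) r<s) (λ c u ou → subst (_< s) (sym (P-degree c u ou)) (ρ<s c)) root root-new

  initial : Σ Col Partial
  initial = start P-sym (λ c → <⇒≤ (ρ<s c)) P-degree (trans ∑ℓ (sym new-slots))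
    (*-cancelˡ-≡ _ _ 2 (+-cancelʳ-≡ (lam * p) _ _ (trans 2∑E (sym 2pairs))))
    (λ c → trans (cong (λ z → z * s + (z * (s ∸ ρ c) + 2 * E c)) ∑-o) (proj₂ (inner-edges c)))

  sufficiency : Extends s (<⇒≤ m<n) F
  sufficiency = finish (link-up (balance (proj₂ initial)))
    where
    link-up : (Σ Col λ col → Partial col × Regular col) → Σ Col λ col → Partial col × Regular col × (∀ c → Connected-in col c)
    link-up (_ , X , reg) = connect-all X reg k₀
    finish : (Σ Col λ col → Partial col × Regular col × (∀ c → Connected-in col c)) → Extends s (<⇒≤ m<n) F
    finish (col , X , reg , conn) =
      record { q = Q ; col = col ; sym = Partial.col-sym X ; regular = λ c v → trans (deg≡degree col c v) (reg c v) } ,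
      (λ c u v → star⇒reach (conn c u v)) , φ , Colours.ι-injective ,
      λ i j k i≢j → trans (Partial.agree X (ι i) (ι j) k (old-ι i) (old-ι j) (i≢j ∘ ι-injective)) (P-ι i j k)

theorem8p4 : (m n r s lam : ℕ) → 1 ≤ r → 1 ≤ s → 1 ≤ lam →
    (m>2 : 2 < m) → (m<n : m < n) → (F : Factorization m lam r) →
    Extends s (<⇒≤ m<n) F ⇔
    ((Admissible m r lam × Admissible n s lam) ×
    (r < s × s * (m ∸ 1) ≤ r * (n ∸ 1)) ×
    (s * (m ∸ 1) < r * (n ∸ 1) → 2 * m ≤ n))
theorem8p4 m n r s lam 1≤r 1≤s 1≤lam m>2 m<n F = mk⇔
  (Necessity.necessity 1≤s 1≤lam m>2 m<n F)
  λ (((2∣rm , _) , (2∣sn , s∣)) , (r<s , ratio) , strict) →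
    Sufficiency.sufficiency 1≤r 1≤lam m>2 m<n F 2∣rm 2∣sn s∣ r<s ratio strict
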